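{- For each positive integer $n$, let $F(n)$ be the minimum, over all families $\mathcal H$ of exactly $n$ affine hyperplanes in $\mathbb{R}^n$ that cover $\{0,1\}^n\setminus\{\mathbf 0\}$ and none of which contains the origin $\mathbf 0$, of $\max_{H\in\mathcal H}|H\cap\{0,1\}^n|$. Then, as $n\to\infty$, $$F(n)=(1+o(1))\frac{2^n}{n};\qquad\text{equivalently,}\qquad \lim_{n\to\infty}\frac{nF(n)}{2^n}=1.$$
   Context: An affine hyperplane in $\mathbb{R}^n$ is a set $\{x\in\mathbb{R}^n:\sum_{i=1}^n a_ix_i=b\}$ with $(a_1,\dots,a_n)\neq 0$. A family $\mathcal H$ covers a set $X$ if $X\subseteq\bigcup_{H\in\mathcal H}H$. -}

module Defs where

open import Data.Bool using (Bool; true; false; if_then_else_)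
open import Data.Fin using (Fin)
open import Data.Integer using (+_)
open import Data.List using (List; length)
open import Data.List.Membership.Propositional using (_∈_)
open import Data.List.Relation.Unary.Unique.Propositional using (Unique)
open import Data.Nat as ℕ using (ℕ)
import Data.Nat.Properties as ℕ
open import Data.Product using (∃; _×_; _,_)
open import Data.Rational as ℚ using (ℚ; 0ℚ; 1ℚ; ½; ∣_∣; 1/_)
open import Data.Rational.Properties as ℚ using (module ≤-Reasoning)
open import Data.Rational.Solver using (module +-*-Solver)
open import Data.Vec as Vec using (Vec)
open import Data.Vec.Functional using (Vector; foldr; zipWith)
open import Function using (_⇔_)
open import Level using (0ℓ)
open import Relation.Binary.PropositionalEquality
open import Relation.Nullary using (¬_)
import Relation.Unary as U
open U using (Pred; _≐_)

infix 4 _⟶_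

_⟶_ : (ℕ → ℚ) → ℚ → Set
u ⟶ l = ∀ ε → 0ℚ ℚ.< ε → ∃ λ N → ∀ n → N ℕ.≤ n → ∣ u n ℚ.- l ∣ ℚ.< ε

IsCauchy : (ℕ → ℚ) → Set
IsCauchy u = ∀ ε → 0ℚ ℚ.< ε →
  ∃ λ N → ∀ m n → N ℕ.≤ m → N ℕ.≤ n → ∣ u m ℚ.- u n ∣ ℚ.< ε

private abstract

  half : ℚ → ℚ
  half ε = ε ℚ.* ½

  half+half : ∀ ε → half ε ℚ.+ half ε ≡ ε
  half+half ε = trans (sym (ℚ.*-distribˡ-+ ε ½ ½)) (ℚ.*-identityʳ ε)

  half-pos : ∀ {ε} → 0ℚ ℚ.< ε → 0ℚ ℚ.< half ε
  half-pos {ε} 0<ε = subst (ℚ._< half ε) (ℚ.*-zeroˡ ½) (ℚ.*-monoˡ-<-pos ½ 0<ε)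

  const-cauchy : ∀ q → IsCauchy (λ _ → q)
  const-cauchy q ε 0<ε =
    0 , λ _ _ _ _ → subst (λ d → ∣ d ∣ ℚ.< ε) (sym (ℚ.+-inverseʳ q)) 0<ε

  +-cauchy : ∀ u v → IsCauchy u → IsCauchy v → IsCauchy (λ n → u n ℚ.+ v n)
  +-cauchy u v cu cv ε 0<ε with cu (half ε) (half-pos 0<ε) | cv (half ε) (half-pos 0<ε)
  ... | M , hu | N , hv = M ℕ.⊔ N , λ m n p q → begin-strict
      ∣ (u m ℚ.+ v m) ℚ.- (u n ℚ.+ v n) ∣
    ≡⟨ cong ∣_∣ (lemma (u m) (v m) (u n) (v n)) ⟩
      ∣ (u m ℚ.- u n) ℚ.+ (v m ℚ.- v n) ∣
    ≤⟨ ℚ.∣p+q∣≤∣p∣+∣q∣ (u m ℚ.- u n) (v m ℚ.- v n) ⟩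
      ∣ u m ℚ.- u n ∣ ℚ.+ ∣ v m ℚ.- v n ∣
    <⟨ ℚ.+-mono-< (hu m n (ℕ.m⊔n≤o⇒m≤o M N p) (ℕ.m⊔n≤o⇒m≤o M N q))
                  (hv m n (ℕ.m⊔n≤o⇒n≤o M N p) (ℕ.m⊔n≤o⇒n≤o M N q)) ⟩
      half ε ℚ.+ half ε
    ≡⟨ half+half ε ⟩
      ε ∎
    where
    open ≤-Reasoning
    lemma : ∀ a b c d → (a ℚ.+ b) ℚ.- (c ℚ.+ d) ≡ (a ℚ.- c) ℚ.+ (b ℚ.- d)
    lemma = solve 4 (λ a b c d → (a :+ b) :- (c :+ d) := (a :- c) :+ (b :- d)) refl
      where open +-*-Solver

  eventually-bounded : ∀ u → IsCauchy u →
    ∃ λ K → 0ℚ ℚ.< K × ∃ λ N → ∀ n → N ℕ.≤ n → ∣ u n ∣ ℚ.≤ K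
  eventually-bounded u cu with cu 1ℚ (ℚ.positive⁻¹ 1ℚ)
  ... | N , h = ∣ u N ∣ ℚ.+ 1ℚ
              , ℚ.+-mono-≤-< (ℚ.nonNegative⁻¹ ∣ u N ∣ {{ℚ.∣-∣-nonNeg (u N)}}) (ℚ.positive⁻¹ 1ℚ)
              , N , λ n p → begin
      ∣ u n ∣
    ≡⟨ cong ∣_∣ (lemma (u N) (u n)) ⟩
      ∣ u N ℚ.+ (u n ℚ.- u N) ∣
    ≤⟨ ℚ.∣p+q∣≤∣p∣+∣q∣ (u N) (u n ℚ.- u N) ⟩
      ∣ u N ∣ ℚ.+ ∣ u n ℚ.- u N ∣
    ≤⟨ ℚ.+-monoʳ-≤ ∣ u N ∣ (ℚ.<⇒≤ (h n N p ℕ.≤-refl)) ⟩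
      ∣ u N ∣ ℚ.+ 1ℚ ∎
    where
    open ≤-Reasoning
    lemma : ∀ a b → b ≡ a ℚ.+ (b ℚ.- a)
    lemma = solve 2 (λ a b → b := a :+ (b :- a)) refl
      where open +-*-Solver

  scale : ∀ {K ε} → 0ℚ ℚ.< K → 0ℚ ℚ.< ε → ∃ λ δ → 0ℚ ℚ.< δ × K ℚ.* δ ≡ ε
  scale {K} {ε} 0<K 0<ε = (1/ K) ℚ.* ε , δ-pos , Kδ
    where
    instance
      posK : ℚ.Positive K
      posK = ℚ.positive 0<K
      nzK : ℚ.NonZero K
      nzK = ℚ.pos⇒nonZero K
      pos1/K : ℚ.Positive (1/ K)
      pos1/K = ℚ.1/pos⇒pos K
    δ-pos : 0ℚ ℚ.< (1/ K) ℚ.* ε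
    δ-pos = subst (ℚ._< (1/ K) ℚ.* ε) (ℚ.*-zeroʳ (1/ K)) (ℚ.*-monoʳ-<-pos (1/ K) 0<ε)
    Kδ : K ℚ.* ((1/ K) ℚ.* ε) ≡ ε
    Kδ = trans (sym (ℚ.*-assoc K (1/ K) ε))
           (trans (cong (ℚ._* ε) (ℚ.*-inverseʳ K)) (ℚ.*-identityˡ ε))

  *-bound : ∀ {K e} a d → 0ℚ ℚ.< K → ∣ a ∣ ℚ.≤ K → ∣ d ∣ ℚ.< e → ∣ a ℚ.* d ∣ ℚ.≤ K ℚ.* e
  *-bound {K} {e} a d 0<K a≤K d<e = begin
      ∣ a ℚ.* d ∣
    ≡⟨ ℚ.∣p*q∣≡∣p∣*∣q∣ a d ⟩
      ∣ a ∣ ℚ.* ∣ d ∣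
    ≤⟨ ℚ.*-monoʳ-≤-nonNeg ∣ d ∣ {{ℚ.∣-∣-nonNeg d}} a≤K ⟩
      K ℚ.* ∣ d ∣
    ≤⟨ ℚ.*-monoˡ-≤-nonNeg K {{ℚ.nonNegative (ℚ.<⇒≤ 0<K)}} (ℚ.<⇒≤ d<e) ⟩
      K ℚ.* e ∎
    where open ≤-Reasoning

  half< : ∀ {x} → 0ℚ ℚ.< x → half x ℚ.< x
  half< {x} 0<x = begin-strict
      half x
    ≡⟨ ℚ.+-identityʳ (half x) ⟨
      half x ℚ.+ 0ℚ
    <⟨ ℚ.+-monoʳ-< (half x) (half-pos 0<x) ⟩
      half x ℚ.+ half x
    ≡⟨ half+half x ⟩
      x ∎
    where open ≤-Reasoning

  *-close : ∀ {K L δ η ε} a b c d → 0ℚ ℚ.< K → 0ℚ ℚ.< L → 0ℚ ℚ.< ε →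
            K ℚ.* δ ≡ half (half ε) → L ℚ.* η ≡ half ε →
            ∣ a ∣ ℚ.≤ K → ∣ d ∣ ℚ.≤ L → ∣ b ℚ.- d ∣ ℚ.< δ → ∣ a ℚ.- c ∣ ℚ.< η →
            ∣ (a ℚ.* b) ℚ.- (c ℚ.* d) ∣ ℚ.< ε
  *-close {K} {L} {δ} {η} {ε} a b c d 0<K 0<L 0<ε Kδ Lη a≤K d≤L b-d a-c = begin-strict
      ∣ (a ℚ.* b) ℚ.- (c ℚ.* d) ∣
    ≡⟨ cong ∣_∣ (lemma a b c d) ⟩
      ∣ a ℚ.* (b ℚ.- d) ℚ.+ d ℚ.* (a ℚ.- c) ∣
    ≤⟨ ℚ.∣p+q∣≤∣p∣+∣q∣ (a ℚ.* (b ℚ.- d)) (d ℚ.* (a ℚ.- c)) ⟩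
      ∣ a ℚ.* (b ℚ.- d) ∣ ℚ.+ ∣ d ℚ.* (a ℚ.- c) ∣
    ≤⟨ ℚ.+-mono-≤ (*-bound a (b ℚ.- d) 0<K a≤K b-d) (*-bound d (a ℚ.- c) 0<L d≤L a-c) ⟩
      K ℚ.* δ ℚ.+ L ℚ.* η
    ≡⟨ cong₂ ℚ._+_ Kδ Lη ⟩
      half (half ε) ℚ.+ half ε
    <⟨ ℚ.+-monoˡ-< (half ε) (half< (half-pos 0<ε)) ⟩
      half ε ℚ.+ half ε
    ≡⟨ half+half ε ⟩
      ε ∎
    where
    open ≤-Reasoning
    lemma : ∀ a b c d → (a ℚ.* b) ℚ.- (c ℚ.* d) ≡ a ℚ.* (b ℚ.- d) ℚ.+ d ℚ.* (a ℚ.- c)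
    lemma = solve 4 (λ a b c d → (a :* b) :- (c :* d) := a :* (b :- d) :+ d :* (a :- c)) refl
      where open +-*-Solver

  *-cauchy : ∀ u v → IsCauchy u → IsCauchy v → IsCauchy (λ n → u n ℚ.* v n)
  *-cauchy u v cu cv ε 0<ε =
    let K , 0<K , A , hA = eventually-bounded u cu
        L , 0<L , B , hB = eventually-bounded v cv
        δ , 0<δ , Kδ = scale 0<K (half-pos (half-pos 0<ε))
        η , 0<η , Lη = scale 0<L (half-pos 0<ε)
        M , hM = cv δ 0<δ
        N , hN = cu η 0<η
    in (A ℕ.⊔ B) ℕ.⊔ (M ℕ.⊔ N) , λ m n p q →
    let pAB = ℕ.m⊔n≤o⇒m≤o (A ℕ.⊔ B) (M ℕ.⊔ N) p
        qAB = ℕ.m⊔n≤o⇒m≤o (A ℕ.⊔ B) (M ℕ.⊔ N) q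
        pMN = ℕ.m⊔n≤o⇒n≤o (A ℕ.⊔ B) (M ℕ.⊔ N) p
        qMN = ℕ.m⊔n≤o⇒n≤o (A ℕ.⊔ B) (M ℕ.⊔ N) q
    in *-close (u m) (v m) (u n) (v n) 0<K 0<L 0<ε Kδ Lη
         (hA m (ℕ.m⊔n≤o⇒m≤o A B pAB)) (hB n (ℕ.m⊔n≤o⇒n≤o A B qAB))
         (hM m n (ℕ.m⊔n≤o⇒m≤o M N pMN) (ℕ.m⊔n≤o⇒m≤o M N qMN))
         (hN m n (ℕ.m⊔n≤o⇒n≤o M N pMN) (ℕ.m⊔n≤o⇒n≤o M N qMN))

-- Cantor's real numbers; _≈_ below plays the role of equality of reals.
record ℝ : Set where
  constructor mkℝ
  field
    seq    : ℕ → ℚ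
    cauchy : IsCauchy seq

open ℝ public

infix  4 _≈_
infixl 6 _+_
infixl 7 _*_

_≈_ : ℝ → ℝ → Set
x ≈ y = (λ n → seq x n ℚ.- seq y n) ⟶ 0ℚ

fromℚ : ℚ → ℝ
fromℚ q = mkℝ (λ _ → q) (const-cauchy q)

0ℝ 1ℝ : ℝ
0ℝ = fromℚ 0ℚ
1ℝ = fromℚ 1ℚ

_+_ : ℝ → ℝ → ℝ
x + y = mkℝ (λ n → seq x n ℚ.+ seq y n) (+-cauchy (seq x) (seq y) (cauchy x) (cauchy y))

_*_ : ℝ → ℝ → ℝ
x * y = mkℝ (λ n → seq x n ℚ.* seq y n) (*-cauchy (seq x) (seq y) (cauchy x) (cauchy y))

ℝ^_ : ℕ → Set
ℝ^ n = Vector ℝ n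

origin : ∀ {n} → ℝ^ n
origin _ = 0ℝ

∑ : ∀ {n} → ℝ^ n → ℝ
∑ = foldr _+_ 0ℝ

record Hyperplane (n : ℕ) : Set where
  field
    a   : ℝ^ n
    b   : ℝ
    a≉0 : ¬ (∀ i → a i ≈ 0ℝ)

⟦_⟧ : ∀ {n} → Hyperplane n → Pred (ℝ^ n) 0ℓ
⟦ H ⟧ x = ∑ (zipWith _*_ a x) ≈ b
  where open Hyperplane H

vertex : ∀ {n} → Vec Bool n → ℝ^ n
vertex v i = if Vec.lookup v i then 1ℝ else 0ℝ

-- Distinct bit vectors label distinct points of ℝⁿ, so this is H ∩ {0,1}ⁿ.
_∩cube : ∀ {n} → Hyperplane n → Pred (Vec Bool n) 0ℓ
(H ∩cube) v = vertex v U.∈ ⟦ H ⟧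

HasCardinality : ∀ {A : Set} → Pred A 0ℓ → ℕ → Set
HasCardinality P k = ∃ λ xs → Unique xs × (∀ x → x ∈ xs ⇔ P x) × length xs ≡ k

record Admissible {n : ℕ} (𝓗 : Vector (Hyperplane n) n) : Set where
  field
    -- An injective indexing: the family has n different members, as subsets of ℝⁿ.
    distinct : ∀ i j → ⟦ 𝓗 i ⟧ ≐ ⟦ 𝓗 j ⟧ → i ≡ j
    avoids   : ∀ i → origin U.∉ ⟦ 𝓗 i ⟧
    covers   : ∀ v → v ≢ Vec.replicate n false → ∃ λ i → vertex v U.∈ ⟦ 𝓗 i ⟧

-- For n ≥ 1, says that m is the largest of the numbers |H ∩ {0,1}ⁿ| for H in 𝓗.
MaxIncidence : ∀ {n} → Vector (Hyperplane n) n → ℕ → Set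
MaxIncidence {n} 𝓗 m = ∃ λ (c : Vector ℕ n) →
  (∀ i → HasCardinality (𝓗 i ∩cube) (c i)) × foldr ℕ._⊔_ 0 c ≡ m

Attained : ℕ → Pred ℕ 0ℓ
Attained n m = ∃ λ (𝓗 : Vector (Hyperplane n) n) → Admissible 𝓗 × MaxIncidence 𝓗 m

IsMinimum : Pred ℕ 0ℓ → Pred ℕ 0ℓ
IsMinimum P m = P m × (∀ k → P k → m ℕ.≤ k)

-- n k / 2ⁿ, to be used with k = F(n)
normalised : ℕ → ℕ → ℚ
normalised n k = (+ (n ℕ.* k) ℚ./ (2 ℕ.^ n)) {{ℕ.m^n≢0 2 n}}

{-# OPTIONS --safe #-}
module Submission where

-- Since the n hyperplanes cover 2ⁿ − 1 points, n F(n) ≥ 2ⁿ − 1. For the upper bound, write a point of the cube as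
-- (y , z , u) with y ∈ {0,1}ᵐ, z ∈ {0,1}ᵏ, u ∈ {0,1}ʳ, where m + 1 = q 2ᵏ, and identify j ∈ {0,…,m} with a pair
-- (a , t), j = a + q t, a < q, t a k-bit string. The equation |y| = a + q (t ⊕ z) is affine in (y , z), because the
-- sign of the coefficient of zᵢ may be chosen according to the i-th bit of t; call the resulting hyperplane H_j.
-- For fixed z the map t ↦ t ⊕ z is a permutation, so H_0,…,H_m partition the cube. Each H_j contains exactly the
-- points with |y| ≡ a mod q and one value of z, a fraction about 1 / (q 2ᵏ) = 1 / (m + 1) when m is large compared
-- to q. Only H_0 passes through the origin. It is replaced by k + r hyperplanes, the i-th of which adds N (wᵢ − 1) to
-- the equation of H_0, with w = (z , u) and N > m: it is the part of H_0 with wᵢ = 1, and a point of H_0 with w = 0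
-- is the origin. Choosing q between constant multiples of 1/ε makes m + 1 as close to n as needed.

open import Defs hiding (_+_; _*_)
open import Algebra.Bundles using (AbelianGroup)
import Algebra.Properties.Group
open import Data.Bool as Bool using (Bool; true; false; if_then_else_; _xor_)
open import Data.Bool.Properties using (xor-assoc; xor-comm; xor-same; xor-identityʳ)
open import Data.Fin as Fin using (Fin; zero; suc; toℕ; fromℕ<; join)
open import Data.Fin.Properties using (toℕ-injective; toℕ<n; toℕ-fromℕ<; toℕ-↑ˡ; toℕ-↑ʳ; join-splitAt; splitAt-join)
open import Data.Integer as ℤ using (ℤ; +_; -[1+_]; +[1+_]; 0ℤ; 1ℤ)
import Data.Integer.Properties as ℤ
open import Data.Integer.Tactic.RingSolver using () renaming (solve-∀ to ℤ-solve-∀)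
open import Data.List as List using (List; []; _∷_; length; filter; concat)
open import Data.List.Membership.Propositional using (_∈_)
open import Data.List.Membership.Propositional.Properties using (∈-map⁺; ∈-map⁻; ∈-++⁺ˡ; ∈-++⁺ʳ; ∈-filter⁺; ∈-filter⁻; ∈-concat⁺′; ∈-tabulate⁺)
open import Data.List.Properties using (filter-++; length-++)
open import Data.List.Relation.Binary.Disjoint.Propositional using (Disjoint)
import Data.List.Relation.Unary.All as All
import Data.List.Relation.Unary.AllPairs as AllPairs
open import Data.List.Relation.Unary.Any using (here; there)
open import Data.List.Relation.Unary.Unique.Propositional using (Unique)
import Data.List.Relation.Unary.Unique.Propositional.Properties as Unique
open import Data.Nat using (ℕ; zero; suc; NonZero; _+_; _*_; _^_; _∸_; _⊔_; _≤_; _<_; z≤n; s≤s; _≟_; _≤?_; _<?_; >-nonZero⁻¹)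
open import Data.Nat.Divisibility using (_∣_; _∣?_; divides; ∣m∣n⇒∣m+n; ∣m+n∣m⇒∣n; n∣n; n∣m*n; _∣0; ∣⇒≤)
open import Data.Nat.DivMod using (_/_; _%_; m≡m%n+[m/n]*n; m%n<n; m<n*o⇒m/o<n; [m+kn]%n≡m%n; m<n⇒m%n≡m; m<n⇒m/n≡0; m*n/n≡m; +-distrib-/-∣ʳ)
open import Data.Nat.Properties
open import Data.Nat.Tactic.RingSolver using (solve-∀)
open import Data.Product using (∃; ∃₂; _×_; _,_; proj₁; proj₂)
open import Data.Rational as ℚ using (ℚ; 0ℚ; 1ℚ; mkℚ; toℚᵘ)
open import Data.Rational.Literals using (fromℤ)
import Data.Rational.Properties as ℚ
import Data.Rational.Unnormalised as ℚᵘ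
import Data.Rational.Unnormalised.Properties as ℚᵘ
open import Data.Sum using (_⊎_; inj₁; inj₂)
open import Data.Vec using (Vec; []; _∷_; replicate; zipWith; _++_; map; lookup; _[_]%=_; splitAt)
import Data.Vec.Functional as Vector
open import Data.Vec.Properties using (zipWith-comm; zipWith-replicate; lookup-replicate; lookup-map; map-++; ++-injectiveˡ; ∷-injectiveʳ; ≡-dec)
open import Function using (_∘_; _⇔_; mk⇔; Equivalence; case_of_)
open import Level using (0ℓ)
open import Relation.Binary.PropositionalEquality
open import Relation.Nullary using (Dec; yes; no; does; ¬_; contradiction)
open import Relation.Nullary.Decidable using (dec-true; dec-false)
open import Relation.Unary as U using (Pred; Decidable)
open import Algebra.Properties.CommutativeSemigroup +-commutativeSemigroup using (interchange)

private
  module ℚ-group = Algebra.Properties.Group ℚ.+-0-group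
  module ℤ-group = Algebra.Properties.Group (AbelianGroup.group ℤ.+-0-abelianGroup)

-- Sums over the cube

⟪_⟫ : {P : Set} → Dec P → ℕ
⟪ P? ⟫ = if does P? then 1 else 0

⟪⟫-true : {P : Set} (P? : Dec P) → P → ⟪ P? ⟫ ≡ 1
⟪⟫-true P? p rewrite dec-true P? p = refl

⟪⟫-mono : {P Q : Set} {P? : Dec P} {Q? : Dec Q} → (P → Q) → ⟪ P? ⟫ ≤ ⟪ Q? ⟫
⟪⟫-mono {P? = no _}              _ = z≤n
⟪⟫-mono {P? = yes p} {Q? = Q?} f = ≤-reflexive (sym (⟪⟫-true Q? (f p)))

⟪⟫≤1 : {P : Set} (P? : Dec P) → ⟪ P? ⟫ ≤ 1
⟪⟫≤1 (yes _) = ≤-refl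
⟪⟫≤1 (no _)  = z≤n

-- Recursion on the first coordinate rather than a sum over a list: `∑ᶜ-++` then splits a point into
-- blocks with no rearrangement.
∑ᶜ : ∀ n → (Vec Bool n → ℕ) → ℕ
∑ᶜ zero    f = f []
∑ᶜ (suc n) f = ∑ᶜ n (f ∘ (false ∷_)) + ∑ᶜ n (f ∘ (true ∷_))

∑ᶜ-mono : ∀ n {f g} → (∀ v → f v ≤ g v) → ∑ᶜ n f ≤ ∑ᶜ n g
∑ᶜ-mono zero    f≤g = f≤g []
∑ᶜ-mono (suc n) f≤g = +-mono-≤ (∑ᶜ-mono n (f≤g ∘ (false ∷_))) (∑ᶜ-mono n (f≤g ∘ (true ∷_)))

∑ᶜ-cong : ∀ n {f g} → (∀ v → f v ≡ g v) → ∑ᶜ n f ≡ ∑ᶜ n g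
∑ᶜ-cong zero    f≡g = f≡g []
∑ᶜ-cong (suc n) f≡g = cong₂ _+_ (∑ᶜ-cong n (f≡g ∘ (false ∷_))) (∑ᶜ-cong n (f≡g ∘ (true ∷_)))

∑ᶜ-+ : ∀ n f g → ∑ᶜ n (λ v → f v + g v) ≡ ∑ᶜ n f + ∑ᶜ n g
∑ᶜ-+ zero    f g = refl
∑ᶜ-+ (suc n) f g
  rewrite ∑ᶜ-+ n (f ∘ (false ∷_)) (g ∘ (false ∷_)) | ∑ᶜ-+ n (f ∘ (true ∷_)) (g ∘ (true ∷_))
  = interchange (∑ᶜ n (f ∘ (false ∷_))) _ _ _

p*c+p*c≡2*p*c : ∀ p c → p * c + p * c ≡ 2 * p * c
p*c+p*c≡2*p*c = solve-∀

∑ᶜ-const : ∀ n c → ∑ᶜ n (λ _ → c) ≡ 2 ^ n * c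
∑ᶜ-const zero    c = sym (+-identityʳ c)
∑ᶜ-const (suc n) c rewrite ∑ᶜ-const n c = p*c+p*c≡2*p*c (2 ^ n) c

∑ᶜ-*ˡ : ∀ n c f → ∑ᶜ n (λ v → c * f v) ≡ c * ∑ᶜ n f
∑ᶜ-*ˡ zero    c f = refl
∑ᶜ-*ˡ (suc n) c f
  rewrite ∑ᶜ-*ˡ n c (f ∘ (false ∷_)) | ∑ᶜ-*ˡ n c (f ∘ (true ∷_))
  = sym (*-distribˡ-+ c (∑ᶜ n (f ∘ (false ∷_))) (∑ᶜ n (f ∘ (true ∷_))))

∑ᶜ-++ : ∀ m {n} f → ∑ᶜ (m + n) f ≡ ∑ᶜ m (λ v → ∑ᶜ n (λ w → f (v ++ w)))
∑ᶜ-++ zero    f = refl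
∑ᶜ-++ (suc m) f = cong₂ _+_ (∑ᶜ-++ m (f ∘ (false ∷_))) (∑ᶜ-++ m (f ∘ (true ∷_)))

∑ᶜ-zero⊎witness : ∀ n {P : Pred (Vec Bool n) _} (P? : Decidable P) →
  ∑ᶜ n (⟪_⟫ ∘ P?) ≡ 0 ⊎ ∃ P
∑ᶜ-zero⊎witness zero    P? with P? []
... | yes p = inj₂ ([] , p)
... | no  _ = inj₁ refl
∑ᶜ-zero⊎witness (suc n) P?
  with ∑ᶜ-zero⊎witness n (P? ∘ (false ∷_)) | ∑ᶜ-zero⊎witness n (P? ∘ (true ∷_))
... | inj₂ (v , p) | _            = inj₂ (false ∷ v , p)
... | inj₁ _       | inj₂ (v , p) = inj₂ (true ∷ v , p)
... | inj₁ e       | inj₁ e′      = inj₁ (cong₂ _+_ e e′)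

-- Solutions in both halves would differ in the first coordinate, so one half contributes 0 and
-- induction handles the other.
∑ᶜ-unique : ∀ n {P : Pred (Vec Bool n) _} (P? : Decidable P) →
  (∀ {v w} → P v → P w → v ≡ w) → ∑ᶜ n (⟪_⟫ ∘ P?) ≤ 1
∑ᶜ-unique zero    P? _ = ⟪⟫≤1 (P? [])
∑ᶜ-unique (suc n) P? unique
  with ∑ᶜ-zero⊎witness n (P? ∘ (false ∷_)) | ∑ᶜ-zero⊎witness n (P? ∘ (true ∷_))
... | inj₂ (_ , p) | inj₂ (_ , q) = contradiction (unique p q) λ ()
... | inj₁ e       | _            rewrite e = ∑ᶜ-unique n (P? ∘ (true ∷_)) λ p q → ∷-injectiveʳ (unique p q)
... | inj₂ _       | inj₁ e       rewrite e | +-identityʳ (∑ᶜ n (⟪_⟫ ∘ P? ∘ (false ∷_)))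
  = ∑ᶜ-unique n (P? ∘ (false ∷_)) λ p q → ∷-injectiveʳ (unique p q)

-- Equidistribution of |y| modulo q

∣_∣₁ : ∀ {n} → Vec Bool n → ℕ
∣ []        ∣₁ = 0
∣ false ∷ v ∣₁ = ∣ v ∣₁
∣ true  ∷ v ∣₁ = suc ∣ v ∣₁

-- pascal m g x = Σᵢ C(m,i) g(x+i)
pascal : ℕ → (ℕ → ℕ) → ℕ → ℕ
pascal zero    g x = g x
pascal (suc m) g x = pascal m g x + pascal m g (suc x)

pascal-cong : ∀ m {g h} → (∀ x → g x ≡ h x) → ∀ x → pascal m g x ≡ pascal m h x
pascal-cong zero    g≡h x = g≡h x
pascal-cong (suc m) g≡h x = cong₂ _+_ (pascal-cong m g≡h x) (pascal-cong m g≡h (suc x))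

pascal-const : ∀ m c x → pascal m (λ _ → c) x ≡ 2 ^ m * c
pascal-const zero    c x = sym (+-identityʳ c)
pascal-const (suc m) c x rewrite pascal-const m c x | pascal-const m c (suc x) = p*c+p*c≡2*p*c (2 ^ m) c

pascal-∘ : ∀ l m g x → pascal (l + m) g x ≡ pascal l (pascal m g) x
pascal-∘ zero    m g x = refl
pascal-∘ (suc l) m g x = cong₂ _+_ (pascal-∘ l m g x) (pascal-∘ l m g (suc x))

pascal-+ : ∀ m g h x → pascal m (λ x → g x + h x) x ≡ pascal m g x + pascal m h x
pascal-+ zero    g h x = refl
pascal-+ (suc m) g h x rewrite pascal-+ m g h x | pascal-+ m g h (suc x) = interchange (pascal m g x) _ _ _

pascal-shift : ∀ m g x → pascal m (g ∘ suc) x ≡ pascal m g (suc x)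
pascal-shift zero    g x = refl
pascal-shift (suc m) g x = cong₂ _+_ (pascal-shift m g x) (pascal-shift m g (suc x))

window : ℕ → (ℕ → ℕ) → ℕ → ℕ
window zero    g x = 0
window (suc l) g x = g x + window l g (suc x)

-- Both operators are sums of shifts with coefficients independent of the position, so they commute.
pascal-window : ∀ m l g x → window l (pascal m g) x ≡ pascal m (window l g) x
pascal-window m zero    g x = sym (trans (pascal-const m 0 x) (*-zeroʳ (2 ^ m)))
pascal-window m (suc l) g x = begin
  pascal m g x + window l (pascal m g) (suc x)         ≡⟨ cong (λ s → pascal m g x + s) (pascal-window m l g (suc x)) ⟩
  pascal m g x + pascal m (window l g) (suc x)         ≡⟨ cong (λ s → pascal m g x + s) (pascal-shift m (window l g) x) ⟨
  pascal m g x + pascal m (window l g ∘ suc) x         ≡⟨ pascal-+ m g (window l g ∘ suc) x ⟨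
  pascal m (window (suc l) g) x                   ∎
  where open ≡-Reasoning

window-snoc : ∀ l g x → window (suc l) g x ≡ window l g x + g (l + x)
window-snoc zero    g x = +-comm (g x) 0
window-snoc (suc l) g x rewrite window-snoc l g (suc x) | +-suc l x =
  sym (+-assoc (g x) (window l g (suc x)) (g (suc l + x)))

endpoint≤pascal : ∀ l g x → g (l + x) ≤ pascal l g x
endpoint≤pascal zero    g x = ≤-refl
endpoint≤pascal (suc l) g x = ≤-trans (≤-trans (≤-reflexive (cong g (sym (+-suc l x)))) (endpoint≤pascal l g (suc x))) (m≤n+m _ _)

-- All binomial coefficients C(l,i) with 0 ≤ i ≤ l are at least 1.
window≤pascal : ∀ l g x → window (suc l) g x ≤ pascal l g x
window≤pascal zero    g x = ≤-reflexive (+-identityʳ (g x))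
window≤pascal (suc l) g x = begin
  window (suc (suc l)) g x               ≡⟨ window-snoc (suc l) g x ⟩
  window (suc l) g x + g (suc l + x)     ≤⟨ +-mono-≤ (window≤pascal l g x) (≤-reflexive (cong g (sym (+-suc l x)))) ⟩
  pascal l g x + g (l + suc x)                ≤⟨ +-monoʳ-≤ (pascal l g x) (endpoint≤pascal l g (suc x)) ⟩
  pascal l g x + pascal l g (suc x)                ∎
  where open ≤-Reasoning

window-const : ∀ l g {c} → (∀ x → g x ≡ c) → ∀ x → window l g x ≡ l * c
window-const zero    g g≡c x = refl
window-const (suc l) g g≡c x = cong₂ _+_ (g≡c x) (window-const l g g≡c (suc x))

window-+ : ∀ l g h x → window l (λ x → g x + h x) x ≡ window l g x + window l h x
window-+ zero    g h x = refl
window-+ (suc l) g h x rewrite window-+ l g h (suc x) = interchange (g x) _ _ _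

-- Applied to the complement M − g, window≤pascal bounds pascal from above.
pascal-contract : ∀ l g {M} → (∀ x → g x ≤ M) → ∀ x →
  pascal l g x + suc l * M ≤ 2 ^ l * M + window (suc l) g x
pascal-contract l g {M} g≤M x = begin
  pascal l g x + suc l * M                                  ≡⟨ cong (λ s → pascal l g x + s) (window-const (suc l) (λ x → g x + h x) g+h≡M x) ⟨
  pascal l g x + window (suc l) (λ x → g x + h x) x         ≡⟨ cong (λ s → pascal l g x + s) (window-+ (suc l) g h x) ⟩
  pascal l g x + (window (suc l) g x + window (suc l) h x)  ≤⟨ +-monoʳ-≤ (pascal l g x) (+-monoʳ-≤ (window (suc l) g x) (window≤pascal l h x)) ⟩
  pascal l g x + (window (suc l) g x + pascal l h x)             ≡⟨ lemma (pascal l g x) _ _ ⟩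
  (pascal l g x + pascal l h x) + window (suc l) g x             ≡⟨ cong (_+ window (suc l) g x) (pascal-+ l g h x) ⟨
  pascal l (λ x → g x + h x) x + window (suc l) g x         ≡⟨ cong (_+ window (suc l) g x) (pascal-cong l g+h≡M x) ⟩
  pascal l (λ _ → M) x + window (suc l) g x                 ≡⟨ cong (_+ window (suc l) g x) (pascal-const l M x) ⟩
  2 ^ l * M + window (suc l) g x                       ∎
  where
  open ≤-Reasoning
  h : ℕ → ℕ
  h x = M ∸ g x
  g+h≡M : ∀ x → g x + h x ≡ M
  g+h≡M x = m+[n∸m]≡n (g≤M x)
  lemma : ∀ a b c → a + (b + c) ≡ (a + c) + b
  lemma = solve-∀

pascal-bounded : ∀ m g {M} → (∀ x → g x ≤ M) → ∀ x → pascal m g x ≤ 2 ^ m * M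
pascal-bounded zero    g {M} g≤M x = ≤-trans (g≤M x) (≤-reflexive (sym (+-identityʳ M)))
pascal-bounded (suc m) g {M} g≤M x = begin
  pascal m g x + pascal m g (suc x)   ≤⟨ +-mono-≤ (pascal-bounded m g g≤M x) (pascal-bounded m g g≤M (suc x)) ⟩
  2 ^ m * M + 2 ^ m * M     ≡⟨ p*c+p*c≡2*p*c (2 ^ m) M ⟩
  2 ^ suc m * M             ∎
  where open ≤-Reasoning

pascal-∑ᶜ : ∀ m g x → ∑ᶜ m (λ v → g (x + ∣ v ∣₁)) ≡ pascal m g x
pascal-∑ᶜ zero    g x = cong g (+-identityʳ x)
pascal-∑ᶜ (suc m) g x = cong₂ _+_ (pascal-∑ᶜ m g x)
  (trans (∑ᶜ-cong m λ v → cong g (+-suc x ∣ v ∣₁)) (pascal-∑ᶜ m g (suc x)))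

window-0 : ∀ l g x → (∀ i → i < l → g (i + x) ≡ 0) → window l g x ≡ 0
window-0 zero    g x g≡0 = refl
window-0 (suc l) g x g≡0 = cong₂ _+_ (g≡0 0 (s≤s z≤n))
  (window-0 l g (suc x) λ i i<l → trans (cong g (+-suc i x)) (g≡0 (suc i) (s≤s i<l)))

-- Sliding the window by one drops g x and gains g (x + l + 1), its equal.
window-periodic : ∀ l g → (∀ x → g (suc l + x) ≡ g x) → ∀ x → window (suc l) g x ≡ window (suc l) g 0
window-periodic l g per zero    = refl
window-periodic l g per (suc x) = begin
  window (suc l) g (suc x)                ≡⟨ window-snoc l g (suc x) ⟩
  window l g (suc x) + g (l + suc x)      ≡⟨ cong (λ y → window l g (suc x) + g y) (+-suc l x) ⟩
  window l g (suc x) + g (suc l + x)      ≡⟨ cong (λ s → window l g (suc x) + s) (per x) ⟩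
  window l g (suc x) + g x                ≡⟨ +-comm (window l g (suc x)) (g x) ⟩
  window (suc l) g x                      ≡⟨ window-periodic l g per x ⟩
  window (suc l) g 0                      ∎
  where open ≡-Reasoning

-- The weight q on multiples of q makes the mean over a period 1, which keeps the estimates below
-- within the integers.
comb : ℕ → ℕ → ℕ
comb q x = q * ⟪ q ∣? x ⟫

comb-0 : ∀ q {x} → ¬ q ∣ x → comb q x ≡ 0
comb-0 q {x} q∤x rewrite dec-false (q ∣? x) q∤x = *-zeroʳ q

comb-q : ∀ q {x} → q ∣ x → comb q x ≡ q
comb-q q {x} q∣x rewrite ⟪⟫-true (q ∣? x) q∣x = *-identityʳ q

comb≤q : ∀ q x → comb q x ≤ q
comb≤q q x = ≤-trans (*-monoʳ-≤ q (⟪⟫≤1 (q ∣? x))) (≤-reflexive (*-identityʳ q))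

comb-periodic : ∀ q x → comb q (q + x) ≡ comb q x
comb-periodic q x with q ∣? x
... | yes q∣x = trans (comb-q q (∣m∣n⇒∣m+n n∣n q∣x)) (sym (*-identityʳ q))
... | no  q∤x = trans (comb-0 q λ q∣q+x → q∤x (∣m+n∣m⇒∣n q∣q+x n∣n)) (sym (*-zeroʳ q))

-- Among q consecutive integers exactly one is a multiple of q; periodicity moves the window to
-- start at 0, where it is the first.
window-comb : ∀ l x → window (suc l) (comb (suc l)) x ≡ suc l
window-comb l x = trans (window-periodic l (comb (suc l)) (comb-periodic (suc l)) x)
  (trans (cong₂ _+_ (comb-q (suc l) (suc l ∣0))
                    (window-0 l (comb (suc l)) 1 λ i i<l → comb-0 (suc l) (q∤ i i<l)))
         (+-identityʳ (suc l)))
  where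
  q∤ : ∀ i → i < l → ¬ suc l ∣ i + 1
  q∤ i i<l q∣ rewrite +-comm i 1 = <⇒≱ (s≤s i<l) (∣⇒≤ q∣)

-- The mean of `pascal m (comb q)` over any period is exactly 2ᵐ, the reference value for the excess
-- estimated next.
window-pascal-comb : ∀ l m x → window (suc l) (pascal m (comb (suc l))) x ≡ suc l * 2 ^ m
window-pascal-comb l m x = begin
  window (suc l) (pascal m (comb (suc l))) x   ≡⟨ pascal-window m (suc l) (comb (suc l)) x ⟩
  pascal m (window (suc l) (comb (suc l))) x   ≡⟨ pascal-cong m (window-comb l) x ⟩
  pascal m (λ _ → suc l) x                     ≡⟨ pascal-const m (suc l) x ⟩
  2 ^ m * suc l                           ≡⟨ *-comm (2 ^ m) (suc l) ⟩
  suc l * 2 ^ m                           ∎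
  where open ≡-Reasoning

-- A block of l = q - 1 coordinates reaches every residue class, so by `pascal-contract` it
-- multiplies the excess over the mean by at most B, while the mean is multiplied by B + 1. The
-- relative excess decays like (B/(B+1))ᵗ.
pascal-comb-decay : ∀ l {B} → 2 ^ l ≡ suc B → ∀ t x →
  pascal (t * l) (comb (suc l)) x ≤ 2 ^ (t * l) + B ^ t * suc l
pascal-comb-decay l {B} 2^l≡1+B zero    x = ≤-trans (comb≤q (suc l) x) (≤-trans (m≤n+m (suc l) 1) (≤-reflexive (cong suc (sym (+-identityʳ (suc l))))))
pascal-comb-decay l {B} 2^l≡1+B (suc t) x = +-cancelʳ-≤ (q * M) _ _ (begin
  pascal (l + t * l) (comb q) x + q * M              ≡⟨ cong (_+ q * M) (pascal-∘ l (t * l) (comb q) x) ⟩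
  pascal l (pascal (t * l) (comb q)) x + q * M            ≤⟨ pascal-contract l (pascal (t * l) (comb q)) (pascal-comb-decay l 2^l≡1+B t) x ⟩
  2 ^ l * M + window q (pascal (t * l) (comb q)) x   ≡⟨ cong (λ s → 2 ^ l * M + s) (window-pascal-comb l (t * l) x) ⟩
  2 ^ l * M + q * P                             ≡⟨ cong (λ b → b * M + q * P) 2^l≡1+B ⟩
  -- The contraction gives the excess the factor 2ˡ - q = B - l; adding l copies of the old excess
  -- weakens it to B.
  suc B * M + q * P                             ≤⟨ m≤m+n (suc B * M + q * P) (l * (B ^ t * q)) ⟩
  suc B * M + q * P + l * (B ^ t * q)           ≡⟨ lemma B P (B ^ t) l ⟩
  (suc B * P + B * B ^ t * q) + q * M           ≡⟨ cong (λ b → (b * P + B * B ^ t * q) + q * M) 2^l≡1+B ⟨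
  (2 ^ l * P + B * B ^ t * q) + q * M           ≡⟨ cong (λ p → (p + B * B ^ t * q) + q * M) (^-distribˡ-+-* 2 l (t * l)) ⟨
  (2 ^ (l + t * l) + B ^ suc t * q) + q * M     ∎)
  where
  open ≤-Reasoning
  q = suc l
  P = 2 ^ (t * l)
  M = P + B ^ t * q
  lemma : ∀ B P C l → suc B * (P + C * suc l) + suc l * P + l * (C * suc l)
                    ≡ (suc B * P + B * C * suc l) + suc l * (P + C * suc l)
  lemma = solve-∀

-- This is (1 + 1/B)ᵗ ≥ 1 + t/B without denominators; the induction step rests on (B + t + 1)B + t =
-- (B + 1)(B + t).
bernoulli : ∀ B t → (B + t) * B ^ t ≤ B * suc B ^ t
bernoulli B zero    = ≤-reflexive (cong (_* 1) (+-identityʳ B))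
bernoulli B (suc t) = begin
  (B + suc t) * (B * B ^ t)                ≤⟨ m≤m+n _ (t * B ^ t) ⟩
  (B + suc t) * (B * B ^ t) + t * B ^ t    ≡⟨ lemma B t (B ^ t) ⟩
  suc B * ((B + t) * B ^ t)                ≤⟨ *-monoʳ-≤ (suc B) (bernoulli B t) ⟩
  suc B * (B * suc B ^ t)                  ≡⟨ lemma′ B (suc B ^ t) ⟩
  B * (suc B * suc B ^ t)                  ∎
  where
  open ≤-Reasoning
  lemma : ∀ B t C → (B + suc t) * (B * C) + t * C ≡ suc B * ((B + t) * C)
  lemma = solve-∀
  lemma′ : ∀ B C → suc B * (B * C) ≡ B * (suc B * C)
  lemma′ = solve-∀

exponential-gap : ∀ B c → ∃ λ t → c * suc B ^ t ≤ suc (suc B) ^ t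
exponential-gap B′ c = t , *-cancelˡ-≤ B (begin
  B * (c * B ^ t)         ≡⟨ lemma B c (B ^ t) ⟩
  (c * B) * B ^ t         ≤⟨ *-monoˡ-≤ (B ^ t) (m≤n+m (c * B) B) ⟩
  (B + c * B) * B ^ t     ≤⟨ bernoulli B t ⟩
  B * suc B ^ t           ∎)
  where
  open ≤-Reasoning
  B = suc B′
  -- With this t the factor B + t in `bernoulli` is at least c * B.
  t = c * B
  lemma : ∀ B c C → B * (c * C) ≡ (c * B) * C
  lemma = solve-∀

-- After t blocks the excess is at most 1/E of the mean. The remaining m - tl coordinates only form
-- weighted sums of shifts, so the bound persists for every larger m, uniformly in x.
equidistribution : ∀ q → 2 ≤ q → ∀ E → ∃ λ N → ∀ m → N ≤ m → ∀ x →
  E * (q * ∑ᶜ m (λ v → ⟪ q ∣? (x + ∣ v ∣₁) ⟫)) ≤ suc E * 2 ^ m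
equidistribution (suc zero) (s≤s ())
equidistribution q@(suc l@(suc l′)) 2≤q E = t * l , λ m tl≤m x → begin
  E * (q * ∑ᶜ m (λ v → ⟪ q ∣? (x + ∣ v ∣₁) ⟫))        ≡⟨ cong (E *_) (∑ᶜ-*ˡ m q (λ v → ⟪ q ∣? (x + ∣ v ∣₁) ⟫)) ⟨
  E * ∑ᶜ m (λ v → comb q (x + ∣ v ∣₁))                ≡⟨ cong (E *_) (pascal-∑ᶜ m (comb q) x) ⟩
  E * pascal m (comb q) x                                  ≡⟨ cong (λ m → E * pascal m (comb q) x) (m∸n+n≡m tl≤m) ⟨
  E * pascal (m ∸ t * l + t * l) (comb q) x                ≡⟨ cong (E *_) (pascal-∘ (m ∸ t * l) (t * l) (comb q) x) ⟩
  E * pascal (m ∸ t * l) (pascal (t * l) (comb q)) x            ≤⟨ *-monoʳ-≤ E (pascal-bounded (m ∸ t * l) _ (pascal-comb-decay l 2^l≡2+B t) x) ⟩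
  E * (2 ^ (m ∸ t * l) * (2 ^ (t * l) + suc B ^ t * q))   ≡⟨ lemma E (2 ^ (m ∸ t * l)) (2 ^ (t * l)) (suc B ^ t) q ⟩
  2 ^ (m ∸ t * l) * (E * 2 ^ (t * l) + E * q * suc B ^ t) ≤⟨ *-monoʳ-≤ (2 ^ (m ∸ t * l)) (+-monoʳ-≤ (E * 2 ^ (t * l)) gap) ⟩
  2 ^ (m ∸ t * l) * (E * 2 ^ (t * l) + 2 ^ (t * l))   ≡⟨ lemma′ E (2 ^ (m ∸ t * l)) (2 ^ (t * l)) ⟩
  suc E * (2 ^ (m ∸ t * l) * 2 ^ (t * l))             ≡⟨ cong (suc E *_) (^-distribˡ-+-* 2 (m ∸ t * l) (t * l)) ⟨
  suc E * 2 ^ (m ∸ t * l + t * l)                     ≡⟨ cong (λ m → suc E * 2 ^ m) (m∸n+n≡m tl≤m) ⟩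
  suc E * 2 ^ m                                       ∎
  where
  open ≤-Reasoning
  -- `exponential-gap` compares the bases `suc B` and `suc (suc B)`, so the decay is applied with
  -- `suc B` = 2ˡ - 1.
  B = 2 ^ l ∸ 2
  2^l≡2+B : 2 ^ l ≡ suc (suc B)
  2^l≡2+B = sym (m+[n∸m]≡n {2} (*-monoʳ-≤ 2 (m^n>0 2 l′)))
  t = proj₁ (exponential-gap B (E * q))
  gap : E * q * suc B ^ t ≤ 2 ^ (t * l)
  gap = ≤-trans (proj₂ (exponential-gap B (E * q))) (≤-reflexive (trans (cong (_^ t) (sym 2^l≡2+B))
    (trans (^-*-assoc 2 l t) (cong (2 ^_) (*-comm l t)))))
  lemma : ∀ E P R C q → E * (P * (R + C * q)) ≡ P * (E * R + E * q * C)
  lemma = solve-∀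
  lemma′ : ∀ E P R → P * (E * R + R) ≡ suc E * (P * R)
  lemma′ = solve-∀

-- Bit strings and linear forms

-- Least significant bit first, matching the doubling of the weight in `flips`.
fromBits : ∀ {k} → Vec Bool k → ℕ
fromBits []      = 0
fromBits (b ∷ t) = (if b then 1 else 0) + 2 * fromBits t

fromBits-injective : ∀ {k} (t t′ : Vec Bool k) → fromBits t ≡ fromBits t′ → t ≡ t′
fromBits-injective []          []           _  = refl
fromBits-injective (false ∷ t) (false ∷ t′) eq = cong (false ∷_) (fromBits-injective t t′ (*-cancelˡ-≡ _ _ 2 eq))
fromBits-injective (true ∷ t)  (true ∷ t′)  eq = cong (true ∷_) (fromBits-injective t t′ (*-cancelˡ-≡ _ _ 2 (suc-injective eq)))
fromBits-injective (false ∷ t) (true ∷ t′)  eq = contradiction eq (even≢odd (fromBits t) (fromBits t′))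
fromBits-injective (true ∷ t)  (false ∷ t′) eq = contradiction (sym eq) (even≢odd (fromBits t′) (fromBits t))

fromBits-0 : ∀ k → fromBits (replicate k false) ≡ 0
fromBits-0 zero    = refl
fromBits-0 (suc k) rewrite fromBits-0 k = refl

fromBits<2^k : ∀ {k} (t : Vec Bool k) → fromBits t < 2 ^ k
fromBits<2^k []          = s≤s z≤n
fromBits<2^k (false ∷ t) = *-monoʳ-< 2 (fromBits<2^k t)
fromBits<2^k (true ∷ t)  = ≤-trans (≤-reflexive (sym (*-suc 2 (fromBits t)))) (*-monoʳ-≤ 2 (fromBits<2^k t))

increment : ∀ {k} → Vec Bool k → Vec Bool k
increment []          = []
increment (false ∷ t) = true ∷ t
increment (true ∷ t)  = false ∷ increment t

-- Counts up from the zero string; `increment` wraps around on overflow, hence the bound x < 2ᵏ in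
-- `fromBits-toBits`.
toBits : ∀ k → ℕ → Vec Bool k
toBits k zero    = replicate k false
toBits k (suc x) = increment (toBits k x)

fromBits-increment : ∀ {k} (t : Vec Bool k) → suc (fromBits t) < 2 ^ k → fromBits (increment t) ≡ suc (fromBits t)
fromBits-increment []          (s≤s ())
fromBits-increment (false ∷ t) _   = refl
fromBits-increment (true ∷ t)  1+<
  rewrite sym (*-suc 2 (fromBits t)) | fromBits-increment t (*-cancelˡ-< 2 _ _ 1+<)
  = refl

fromBits-toBits : ∀ k {x} → x < 2 ^ k → fromBits (toBits k x) ≡ x
fromBits-toBits k {zero}  _ = fromBits-0 k
fromBits-toBits k {suc x} 1+x< with ih ← fromBits-toBits k (<-trans (n<1+n x) 1+x<)
  = trans (fromBits-increment (toBits k x) (subst (λ y → suc y < 2 ^ k) (sym ih) 1+x<)) (cong suc ih)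

toBits-fromBits : ∀ {k} (t : Vec Bool k) → toBits k (fromBits t) ≡ t
toBits-fromBits {k} t = fromBits-injective _ t (fromBits-toBits k (fromBits<2^k t))

infixl 6 _⊕_

_⊕_ : ∀ {k} → Vec Bool k → Vec Bool k → Vec Bool k
_⊕_ = zipWith _xor_

⊕-cancelʳ : ∀ {k} (t z : Vec Bool k) → (t ⊕ z) ⊕ z ≡ t
⊕-cancelʳ []      []      = refl
⊕-cancelʳ (b ∷ t) (c ∷ z) = cong₂ _∷_
  (trans (xor-assoc b c c) (trans (cong (b xor_) (xor-same c)) (xor-identityʳ b))) (⊕-cancelʳ t z)

⊕-comm : ∀ {k} (t z : Vec Bool k) → t ⊕ z ≡ z ⊕ t
⊕-comm = zipWith-comm xor-comm

⊕-injectiveʳ : ∀ {k} (t {z z′} : Vec Bool k) → t ⊕ z ≡ t ⊕ z′ → z ≡ z′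
⊕-injectiveʳ t {z} {z′} eq = begin
  z              ≡⟨ ⊕-cancelʳ z t ⟨
  (z ⊕ t) ⊕ t    ≡⟨ cong (_⊕ t) (⊕-comm z t) ⟩
  (t ⊕ z) ⊕ t    ≡⟨ cong (_⊕ t) eq ⟩
  (t ⊕ z′) ⊕ t   ≡⟨ cong (_⊕ t) (⊕-comm t z′) ⟩
  (z′ ⊕ t) ⊕ t   ≡⟨ ⊕-cancelʳ z′ t ⟩
  z′             ∎
  where open ≡-Reasoning

dot : ∀ {n} → Vec ℤ n → Vec ℤ n → ℤ
dot []       []       = 0ℤ
dot (c ∷ cs) (x ∷ xs) = c ℤ.* x ℤ.+ dot cs xs

dot-++ : ∀ {m n} (c x : Vec ℤ m) (d y : Vec ℤ n) → dot (c ++ d) (x ++ y) ≡ dot c x ℤ.+ dot d y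
dot-++ []       []       d y = sym (ℤ.+-identityˡ _)
dot-++ (c ∷ cs) (x ∷ xs) d y = trans (cong (ℤ._+_ (c ℤ.* x)) (dot-++ cs xs d y)) (sym (ℤ.+-assoc (c ℤ.* x) (dot cs xs) (dot d y)))

dot-zeroˡ : ∀ {n} (x : Vec ℤ n) → dot (replicate n 0ℤ) x ≡ 0ℤ
dot-zeroˡ []       = refl
dot-zeroˡ (x ∷ xs) = trans (ℤ.+-identityˡ _) (dot-zeroˡ xs)

dot-zeroʳ : ∀ {n} (c : Vec ℤ n) → dot c (replicate n 0ℤ) ≡ 0ℤ
dot-zeroʳ []       = refl
dot-zeroʳ (c ∷ cs) = trans (cong₂ ℤ._+_ (ℤ.*-zeroʳ c) (dot-zeroʳ cs)) refl

dot-updateAt : ∀ {n} (c x : Vec ℤ n) i N →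
  dot (c [ i ]%= (ℤ._+ N)) x ≡ dot c x ℤ.+ N ℤ.* lookup x i
dot-updateAt (c ∷ cs) (x ∷ xs) zero    N = lemma c x N (dot cs xs)
  where
  lemma : ∀ c x N d → (c ℤ.+ N) ℤ.* x ℤ.+ d ≡ (c ℤ.* x ℤ.+ d) ℤ.+ N ℤ.* x
  lemma = ℤ-solve-∀
dot-updateAt (c ∷ cs) (x ∷ xs) (suc i) N =
  trans (cong (ℤ._+_ (c ℤ.* x)) (dot-updateAt cs xs i N)) (sym (ℤ.+-assoc (c ℤ.* x) (dot cs xs) (N ℤ.* lookup xs i)))

bit : Bool → ℤ
bit b = if b then 1ℤ else 0ℤ

dot-1s : ∀ {n} (y : Vec Bool n) → dot (replicate n 1ℤ) (map bit y) ≡ + ∣ y ∣₁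
dot-1s []          = refl
dot-1s (false ∷ y) = trans (ℤ.+-identityˡ _) (dot-1s y)
dot-1s (true ∷ y)  = cong (ℤ._+_ 1ℤ) (dot-1s y)

pos-fromBits : ∀ {k} b (t : Vec Bool k) → + fromBits (b ∷ t) ≡ bit b ℤ.+ + 2 ℤ.* + fromBits t
pos-fromBits true  t = cong (ℤ._+_ 1ℤ) (ℤ.pos-* 2 (fromBits t))
pos-fromBits false t = cong (ℤ._+_ 0ℤ) (ℤ.pos-* 2 (fromBits t))

flips : ∀ {k} → ℕ → Vec Bool k → Vec ℤ k
flips q []      = []
flips q (b ∷ t) = (if b then + q else ℤ.- + q) ∷ flips (2 * q) t

-- Clearing a bit of t subtracts q 2ⁱ and setting one adds it, so t ⊕ z is linear in z for fixed t.
dot-flips : ∀ {k} q (t z : Vec Bool k) →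
  dot (flips q t) (map bit z) ℤ.+ + q ℤ.* + fromBits (t ⊕ z) ≡ + q ℤ.* + fromBits t
dot-flips q []      []      = ℤ.+-identityˡ _
dot-flips q (b ∷ t) (c ∷ z)
  = begin
  s b ℤ.* bit c ℤ.+ D ℤ.+ + q ℤ.* + fromBits ((b ∷ t) ⊕ (c ∷ z))
    ≡⟨ cong (λ v → s b ℤ.* bit c ℤ.+ D ℤ.+ + q ℤ.* v) (pos-fromBits (b xor c) (t ⊕ z)) ⟩
  s b ℤ.* bit c ℤ.+ D ℤ.+ + q ℤ.* (bit (b xor c) ℤ.+ + 2 ℤ.* V)
    ≡⟨ lemma (s b) (bit c) D (+ q) (bit (b xor c)) V ⟩
  (s b ℤ.* bit c ℤ.+ + q ℤ.* bit (b xor c)) ℤ.+ (D ℤ.+ (+ 2 ℤ.* + q) ℤ.* V)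
    ≡⟨ cong₂ ℤ._+_ (flip b c) (cong (λ p → D ℤ.+ p ℤ.* V) (sym (ℤ.pos-* 2 q))) ⟩
  + q ℤ.* bit b ℤ.+ (D ℤ.+ + (2 * q) ℤ.* V)
    ≡⟨ cong (ℤ._+_ (+ q ℤ.* bit b)) (dot-flips (2 * q) t z) ⟩
  + q ℤ.* bit b ℤ.+ + (2 * q) ℤ.* + fromBits t
    ≡⟨ cong (λ p → + q ℤ.* bit b ℤ.+ p ℤ.* + fromBits t) (ℤ.pos-* 2 q) ⟩
  + q ℤ.* bit b ℤ.+ (+ 2 ℤ.* + q) ℤ.* + fromBits t
    ≡⟨ lemma′ (+ q) (bit b) (+ fromBits t) ⟩
  + q ℤ.* (bit b ℤ.+ + 2 ℤ.* + fromBits t)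
    ≡⟨ cong (ℤ._*_ (+ q)) (pos-fromBits b t) ⟨
  + q ℤ.* + fromBits (b ∷ t)
    ∎
  where
  open ≡-Reasoning
  V = + fromBits (t ⊕ z)
  D = dot (flips (2 * q) t) (map bit z)
  s : Bool → ℤ
  s b = if b then + q else ℤ.- + q
  lemma : ∀ s c D q x V → s ℤ.* c ℤ.+ D ℤ.+ q ℤ.* (x ℤ.+ + 2 ℤ.* V) ≡ (s ℤ.* c ℤ.+ q ℤ.* x) ℤ.+ (D ℤ.+ (+ 2 ℤ.* q) ℤ.* V)
  lemma = ℤ-solve-∀
  lemma′ : ∀ q x V → q ℤ.* x ℤ.+ (+ 2 ℤ.* q) ℤ.* V ≡ q ℤ.* (x ℤ.+ + 2 ℤ.* V)
  lemma′ = ℤ-solve-∀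
  both : ∀ q → q ℤ.* 1ℤ ℤ.+ q ℤ.* 0ℤ ≡ q ℤ.* 1ℤ
  both = ℤ-solve-∀
  neither : ∀ q → (ℤ.- q) ℤ.* 0ℤ ℤ.+ q ℤ.* 0ℤ ≡ q ℤ.* 0ℤ
  neither = ℤ-solve-∀
  left : ∀ q → q ℤ.* 0ℤ ℤ.+ q ℤ.* 1ℤ ≡ q ℤ.* 1ℤ
  left = ℤ-solve-∀
  right : ∀ q → (ℤ.- q) ℤ.* 1ℤ ℤ.+ q ℤ.* 1ℤ ≡ q ℤ.* 0ℤ
  right = ℤ-solve-∀
  -- On bits b xor c = b - (2b - 1)c, and `s b` is (2b - 1)q.
  flip : ∀ b c → s b ℤ.* bit c ℤ.+ + q ℤ.* bit (b xor c) ≡ + q ℤ.* bit b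
  flip true  true  = both (+ q)
  flip true  false = left (+ q)
  flip false true  = right (+ q)
  flip false false = neither (+ q)

-- Hyperplanes with integer coefficients

-- A nonzero d is refuted by ε = ∣ d ∣. This turns the limit hidden in `≈` into an equation of
-- rationals.
const⟶0 : ∀ {u : ℕ → ℚ} {d} → (∀ N → u N ≡ d) → u ⟶ 0ℚ ⇔ d ≡ 0ℚ
const⟶0 {u} {d} u≡d = mk⇔ to from
  where
  0≤∣d∣ : 0ℚ ℚ.≤ ℚ.∣ d ∣
  0≤∣d∣ = ℚ.nonNegative⁻¹ ℚ.∣ d ∣ {{ℚ.∣-∣-nonNeg d}}
  to : u ⟶ 0ℚ → d ≡ 0ℚ
  to lim with ℚ.∣ d ∣ ℚ.≟ 0ℚ
  ... | yes ∣d∣≡0 = ℚ.∣p∣≡0⇒p≡0 d ∣d∣≡0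
  ... | no  ∣d∣≢0 with N , near ← lim ℚ.∣ d ∣ (ℚ.≰⇒> λ ∣d∣≤0 → ∣d∣≢0 (ℚ.≤-antisym ∣d∣≤0 0≤∣d∣))
    = contradiction (subst (λ e → ℚ.∣ e ∣ ℚ.< ℚ.∣ d ∣) (trans (ℚ.+-identityʳ (u N)) (u≡d N)) (near N ≤-refl)) (ℚ.<-irrefl refl)
  from : d ≡ 0ℚ → u ⟶ 0ℚ
  from d≡0 ε 0<ε = 0 , λ N _ → subst (λ e → ℚ.∣ e ℚ.- 0ℚ ∣ ℚ.< ε) (sym (trans (u≡d N) d≡0)) 0<ε

fromℤ-+ : ∀ a b → fromℤ a ℚ.+ fromℤ b ≡ fromℤ (a ℤ.+ b)
fromℤ-+ a b = trans (cong (ℚ._/ 1) (cong₂ ℤ._+_ (ℤ.*-identityʳ a) (ℤ.*-identityʳ b))) (ℚ.↥p/↧p≡p (fromℤ (a ℤ.+ b)))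

fromℤ-* : ∀ a b → fromℤ a ℚ.* fromℤ b ≡ fromℤ (a ℤ.* b)
fromℤ-* a b = ℚ.↥p/↧p≡p (fromℤ (a ℤ.* b))

p-q≡0⇔p≡q : ∀ {p q} → p ℚ.- q ≡ 0ℚ ⇔ p ≡ q
p-q≡0⇔p≡q {p} {q} = mk⇔ (ℚ-group.x∙y⁻¹≈ε⇒x≈y p q) (ℚ-group.x≈y⇒x∙y⁻¹≈ε)

infix 4 _represents_

-- Termwise equality, stronger than `≈`: arithmetic of Cauchy sequences is termwise, so
-- representation passes through sums and products without estimates.
_represents_ : ℤ → ℝ → Set
z represents x = ∀ N → seq x N ≡ fromℤ z

represents-≈ : ∀ {a b x y} → a represents x → b represents y → x ≈ y ⇔ a ≡ b
represents-≈ {a} {b} a↦x b↦y = mk⇔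
  (λ x≈y → cong ℚ.↥_ (E.to (p-q≡0⇔p≡q {fromℤ a} {fromℤ b}) (E.to x-y x≈y)))
  (λ a≡b → E.from x-y (E.from p-q≡0⇔p≡q (cong fromℤ a≡b)))
  where
  module E = Equivalence
  x-y = const⟶0 (λ N → cong₂ ℚ._-_ (a↦x N) (b↦y N))

toℝ : ℤ → ℝ
toℝ z = fromℚ (fromℤ z)

∑-represents : ∀ {n} (c xs : Vec ℤ n) (x : ℝ^ n) → (∀ i → lookup xs i represents x i) →
  dot c xs represents ∑ (Vector.zipWith Defs._*_ (toℝ ∘ lookup c) x)
∑-represents []       []       x xs↦x N = refl
∑-represents (c ∷ cs) (z ∷ zs) x xs↦x N = begin
  fromℤ c ℚ.* seq (x zero) N ℚ.+ seq (∑ (Vector.zipWith Defs._*_ (toℝ ∘ lookup cs) (x ∘ suc))) N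
    ≡⟨ cong₂ (λ s t → fromℤ c ℚ.* s ℚ.+ t) (xs↦x zero N) (∑-represents cs zs (x ∘ suc) (xs↦x ∘ suc) N) ⟩
  fromℤ c ℚ.* fromℤ z ℚ.+ fromℤ (dot cs zs)
    ≡⟨ cong (ℚ._+ fromℤ (dot cs zs)) (fromℤ-* c z) ⟩
  fromℤ (c ℤ.* z) ℚ.+ fromℤ (dot cs zs)
    ≡⟨ fromℤ-+ (c ℤ.* z) (dot cs zs) ⟩
  fromℤ (dot (c ∷ cs) (z ∷ zs)) ∎
  where open ≡-Reasoning

-- The leading coefficient 1 settles `a≉0` and puts a point of the first axis on each such
-- hyperplane, which `monic-injective` uses to tell them apart.
monic : ∀ {n} → Vec ℤ n → ℤ → Hyperplane (suc n)
monic c b = record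
  { a   = toℝ ∘ lookup (1ℤ ∷ c)
  ; b   = toℝ b
  ; a≉0 = λ a≈0 → contradiction (Equivalence.to (represents-≈ {x = toℝ 1ℤ} {y = 0ℝ} (λ _ → refl) (λ _ → refl)) (a≈0 zero)) 1≢0
  }
  where
  1≢0 : 1ℤ ≢ 0ℤ
  1≢0 ()

∈-monic : ∀ {n} (c : Vec ℤ n) b xs x → (∀ i → lookup xs i represents x i) →
  x U.∈ ⟦ monic c b ⟧ ⇔ dot (1ℤ ∷ c) xs ≡ b
∈-monic c b xs x xs↦x = represents-≈ {x = ∑ (Vector.zipWith Defs._*_ (Hyperplane.a (monic c b)) x)} {y = toℝ b}
  (∑-represents (1ℤ ∷ c) xs x xs↦x) (λ _ → refl)

vertex-represented : ∀ {n} (v : Vec Bool n) i → lookup (map bit v) i represents vertex v i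
vertex-represented (true  ∷ v) zero    N = refl
vertex-represented (false ∷ v) zero    N = refl
vertex-represented (_     ∷ v) (suc i) N = vertex-represented v i N

vertex∈monic : ∀ {n} (c : Vec ℤ n) b v → vertex v U.∈ ⟦ monic c b ⟧ ⇔ dot (1ℤ ∷ c) (map bit v) ≡ b
vertex∈monic c b v = ∈-monic c b (map bit v) (vertex v) (vertex-represented v)

origin∉monic : ∀ {n} (c : Vec ℤ n) {b} → b ≢ 0ℤ → origin U.∉ ⟦ monic c b ⟧
origin∉monic {n} c {b} b≢0 o∈ =
  b≢0 (trans (sym (Equivalence.to (∈-monic c b (replicate (suc n) 0ℤ) origin zeros) o∈)) (dot-zeroʳ (1ℤ ∷ c)))
  where
  zeros : ∀ i → lookup (replicate (suc n) 0ℤ) i represents 0ℝ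
  zeros i N rewrite lookup-replicate i 0ℤ = refl

-- The axis point (b,0,…,0) lies on monic c b, and on no monic c′ b′ with b′ ≢ b.
monic-injective : ∀ {n} (c c′ : Vec ℤ n) b b′ → ⟦ monic c b ⟧ U.≐ ⟦ monic c′ b′ ⟧ → b ≡ b′
monic-injective {n} c c′ b b′ (c⊆c′ , _) =
  trans (sym (dot-axis c′)) (Equivalence.to (∈-monic c′ b′ xs x axis)
    (c⊆c′ {x} (Equivalence.from (∈-monic c b xs x axis) (dot-axis c))))
  where
  xs = b ∷ replicate n 0ℤ
  x = toℝ ∘ lookup xs
  dot-axis : ∀ c → dot (1ℤ ∷ c) xs ≡ b
  dot-axis c = trans (cong₂ ℤ._+_ (ℤ.*-identityˡ b) (dot-zeroʳ c)) (ℤ.+-identityʳ b)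
  axis : ∀ i → lookup xs i represents x i
  axis i N = refl

-- Cardinality of subsets of the cube

cube : ∀ n → List (Vec Bool n)
cube zero    = [] ∷ []
cube (suc n) = List.map (false ∷_) (cube n) List.++ List.map (true ∷_) (cube n)

∈-cube : ∀ {n} (v : Vec Bool n) → v ∈ cube n
∈-cube []          = here refl
∈-cube (false ∷ v) = ∈-++⁺ˡ (∈-map⁺ (false ∷_) (∈-cube v))
∈-cube (true ∷ v)  = ∈-++⁺ʳ _ (∈-map⁺ (true ∷_) (∈-cube v))

cube-unique : ∀ n → Unique (cube n)
cube-unique zero    = All.[] AllPairs.∷ AllPairs.[]
cube-unique (suc n) = Unique.++⁺
  (Unique.map⁺ ∷-injectiveʳ (cube-unique n)) (Unique.map⁺ ∷-injectiveʳ (cube-unique n))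
  disjoint
  where
  disjoint : Disjoint (List.map (false ∷_) (cube n)) (List.map (true ∷_) (cube n))
  disjoint (v∈ , v∈′) with ∈-map⁻ (false ∷_) v∈ | ∈-map⁻ (true ∷_) v∈′
  ... | _ , _ , refl | _ , _ , ()

length-filter-map : ∀ {A B : Set} {P : Pred B 0ℓ} (P? : Decidable P) (f : A → B) xs →
  length (filter P? (List.map f xs)) ≡ length (filter (P? ∘ f) xs)
length-filter-map P? f []       = refl
length-filter-map P? f (x ∷ xs) with does (P? (f x))
... | true  = cong suc (length-filter-map P? f xs)
... | false = length-filter-map P? f xs

length-filter-cube : ∀ n {P : Pred (Vec Bool n) _} (P? : Decidable P) →
  length (filter P? (cube n)) ≡ ∑ᶜ n (⟪_⟫ ∘ P?)
length-filter-cube zero    P? with does (P? [])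
... | true  = refl
... | false = refl
length-filter-cube (suc n) P? = begin
  length (filter P? (List.map (false ∷_) (cube n) List.++ List.map (true ∷_) (cube n)))
    ≡⟨ cong length (filter-++ P? (List.map (false ∷_) (cube n)) _) ⟩
  length (filter P? (List.map (false ∷_) (cube n)) List.++ filter P? (List.map (true ∷_) (cube n)))
    ≡⟨ length-++ (filter P? (List.map (false ∷_) (cube n))) ⟩
  length (filter P? (List.map (false ∷_) (cube n))) + length (filter P? (List.map (true ∷_) (cube n)))
    ≡⟨ cong₂ _+_ (length-filter-map P? (false ∷_) (cube n)) (length-filter-map P? (true ∷_) (cube n)) ⟩
  length (filter (P? ∘ (false ∷_)) (cube n)) + length (filter (P? ∘ (true ∷_)) (cube n))
    ≡⟨ cong₂ _+_ (length-filter-cube n (P? ∘ (false ∷_))) (length-filter-cube n (P? ∘ (true ∷_))) ⟩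
  ∑ᶜ (suc n) (⟪_⟫ ∘ P?) ∎
  where open ≡-Reasoning

-- Membership in a hyperplane is a limit statement about reals; the equivalent integer equation is
-- decidable, so the cube can be filtered by it.
cube-cardinality : ∀ {n} {P Q : Pred (Vec Bool n) _} (Q? : Decidable Q) → (∀ v → P v ⇔ Q v) →
  HasCardinality P (∑ᶜ n (⟪_⟫ ∘ Q?))
cube-cardinality {n} Q? P⇔Q = filter Q? (cube n) , Unique.filter⁺ Q? (cube-unique n)
  , (λ v → mk⇔ (λ v∈ → Equivalence.from (P⇔Q v) (proj₂ (∈-filter⁻ Q? {xs = cube n} v∈)))
               (λ Pv → ∈-filter⁺ Q? (∈-cube v) (Equivalence.to (P⇔Q v) Pv)))
  , length-filter-cube n Q?

-- The construction

some-true : ∀ {n} (w : Vec Bool n) → (∃ λ i → lookup w i ≡ true) ⊎ w ≡ replicate n false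
some-true []          = inj₂ refl
some-true (true ∷ w)  = inj₁ (zero , refl)
some-true (false ∷ w) with some-true w
... | inj₁ (i , wi) = inj₁ (suc i , wi)
... | inj₂ w≡0      = inj₂ (cong (false ∷_) w≡0)

replicate-++ : ∀ m {n} {A : Set} (x : A) → replicate (m + n) x ≡ replicate m x ++ replicate n x
replicate-++ zero    x = refl
replicate-++ (suc m) x = cong (x ∷_) (replicate-++ m x)

∣∣₁-0 : ∀ {n} (v : Vec Bool n) → ∣ v ∣₁ ≡ 0 → v ≡ replicate n false
∣∣₁-0 []          _  = refl
∣∣₁-0 (false ∷ v) ≡0 = cong (false ∷_) (∣∣₁-0 v ≡0)

∣∣₁≤n : ∀ {n} (v : Vec Bool n) → ∣ v ∣₁ ≤ n
∣∣₁≤n []          = z≤n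
∣∣₁≤n (false ∷ v) = m≤n⇒m≤1+n (∣∣₁≤n v)
∣∣₁≤n (true ∷ v)  = s≤s (∣∣₁≤n v)

-- For given y the equation fixes t ⊕ z, hence z, and u is free: at most 2ʳ points. A solution
-- forces ∣ y ∣₁ ≡ a mod q; since l ≡ -1 mod q, this is divisibility of l * a + ∣ y ∣₁, with no
-- subtraction.
fibre-count : ∀ l a {m k} (t : Vec Bool k) r {P : Pred (Vec Bool (m + (k + r))) 0ℓ} (P? : Decidable P) →
  (∀ y z u → P (y ++ (z ++ u)) → ∣ y ∣₁ ≡ a + suc l * fromBits (t ⊕ z)) →
  ∑ᶜ (m + (k + r)) (⟪_⟫ ∘ P?) ≤ 2 ^ r * ∑ᶜ m (λ y → ⟪ suc l ∣? (l * a + ∣ y ∣₁) ⟫)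
fibre-count l a {m} {k} t r P? P⇒ = begin
  ∑ᶜ (m + (k + r)) (⟪_⟫ ∘ P?)
    ≡⟨ ∑ᶜ-++ m _ ⟩
  ∑ᶜ m (λ y → ∑ᶜ (k + r) (λ w → ⟪ P? (y ++ w) ⟫))
    ≤⟨ ∑ᶜ-mono m fibre ⟩
  ∑ᶜ m (λ y → 2 ^ r * ⟪ suc l ∣? (l * a + ∣ y ∣₁) ⟫)
    ≡⟨ ∑ᶜ-*ˡ m (2 ^ r) _ ⟩
  2 ^ r * ∑ᶜ m (λ y → ⟪ suc l ∣? (l * a + ∣ y ∣₁) ⟫) ∎
  where
  open ≤-Reasoning
  On? : ∀ y → Decidable λ z → ∣ y ∣₁ ≡ a + suc l * fromBits (t ⊕ z)
  On? y z = ∣ y ∣₁ ≟ a + suc l * fromBits (t ⊕ z)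
  lemma : ∀ l a v → l * a + (a + suc l * v) ≡ (a + v) * suc l
  lemma = solve-∀
  atMostOne : ∀ y → ∑ᶜ k (⟪_⟫ ∘ On? y) ≤ ⟪ suc l ∣? (l * a + ∣ y ∣₁) ⟫
  atMostOne y with ∑ᶜ-zero⊎witness k (On? y)
  ... | inj₁ ≡0 = ≤-trans (≤-reflexive ≡0) z≤n
  ... | inj₂ (z , y-z) = ≤-trans
    (∑ᶜ-unique k (On? y) λ {z} {z′} p p′ → ⊕-injectiveʳ t (fromBits-injective _ _
      (*-cancelˡ-≡ _ _ (suc l) (+-cancelˡ-≡ a _ _ (trans (sym p) p′)))))
    (≤-reflexive (sym (⟪⟫-true (suc l ∣? (l * a + ∣ y ∣₁))
      (divides (a + fromBits (t ⊕ z)) (trans (cong (_+_ (l * a)) y-z) (lemma l a (fromBits (t ⊕ z))))))))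
  fibre : ∀ y → ∑ᶜ (k + r) (λ w → ⟪ P? (y ++ w) ⟫) ≤ 2 ^ r * ⟪ suc l ∣? (l * a + ∣ y ∣₁) ⟫
  fibre y = begin
    ∑ᶜ (k + r) (λ w → ⟪ P? (y ++ w) ⟫)                  ≡⟨ ∑ᶜ-++ k _ ⟩
    ∑ᶜ k (λ z → ∑ᶜ r (λ u → ⟪ P? (y ++ (z ++ u)) ⟫))    ≤⟨ ∑ᶜ-mono k (λ z → ∑ᶜ-mono r λ u → ⟪⟫-mono {P? = P? (y ++ (z ++ u))} {Q? = On? y z} (P⇒ y z u)) ⟩
    ∑ᶜ k (λ z → ∑ᶜ r (λ _ → ⟪ On? y z ⟫))               ≡⟨ ∑ᶜ-cong k (λ z → ∑ᶜ-const r ⟪ On? y z ⟫) ⟩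
    ∑ᶜ k (λ z → 2 ^ r * ⟪ On? y z ⟫)                    ≡⟨ ∑ᶜ-*ˡ k (2 ^ r) _ ⟩
    2 ^ r * ∑ᶜ k (λ z → ⟪ On? y z ⟫)                    ≤⟨ *-monoʳ-≤ (2 ^ r) (atMostOne y) ⟩
    2 ^ r * ⟪ suc l ∣? (l * a + ∣ y ∣₁) ⟫               ∎

divMod-unique : ∀ {q} .{{_ : NonZero q}} {a} v → a < q → (a + q * v) % q ≡ a × (a + q * v) / q ≡ v
divMod-unique {q} {a} v a<q rewrite *-comm q v
  = trans ([m+kn]%n≡m%n a v q) (m<n⇒m%n≡m a<q)
  , trans (+-distrib-/-∣ʳ a (n∣m*n v)) (cong₂ _+_ (m<n⇒m/n≡0 a<q) (m*n/n≡m v q))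

-- A point of the cube is (y , z , u) with y ∈ {0,1}ᵐ, z ∈ {0,1}ᵏ, u ∈ {0,1}ʳ, where q = suc l and m = suc m′.
module Construction (l k r m′ : ℕ) (1+m≡q2^k : suc (suc m′) ≡ suc l * 2 ^ k) where

  q m n : ℕ
  q = suc l
  m = suc m′
  n = m + (k + r)

  -- `inj₁ j` stands for the hyperplane H_(j+1), `inj₂ i` for one of the k + r hyperplanes that
  -- replace H_0.
  Index : Set
  Index = Fin m ⊎ Fin (k + r)

  -- The constant term. Numbering the whole family from 1 does three jobs: no level is 0, so the
  -- origin is avoided; the levels differ, so the hyperplanes do; and the `inj₂` levels exceed m, as
  -- the N of the replacements must.
  level : Index → ℕ
  level s = suc (toℕ (join m (k + r) s))

  digits : ℕ → Vec Bool k
  digits j = toBits k (j / q)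

  tailCoefficients : ℕ → Vec ℤ (k + r)
  tailCoefficients j = flips q (digits j) ++ replicate r 0ℤ

  -- Only m′ ones are listed, as `monic` supplies the first. For `inj₂ i` the equation of H_0 gains
  -- N wᵢ on the left and N on the right, N being the level.
  coefficients : Index → Vec ℤ (m′ + (k + r))
  coefficients s@(inj₁ _) = replicate m′ 1ℤ ++ tailCoefficients (level s)
  coefficients s@(inj₂ i) = replicate m′ 1ℤ ++ (tailCoefficients 0 [ i ]%= (ℤ._+ + level s))

  On : Index → Pred (Vec Bool n) 0ℓ
  On s v = dot (1ℤ ∷ coefficients s) (map bit v) ≡ + level s

  On? : ∀ s → Decidable (On s)
  On? s v = dot (1ℤ ∷ coefficients s) (map bit v) ℤ.≟ + level s

  -- As z runs over {0,1}ᵏ, digits j ⊕ z runs over all k-bit strings, so for fixed j every y with |y| ≡ j mod q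
  -- is matched by exactly one z: this is what makes the hyperplanes equally full.
  Slice : ℕ → Vec Bool m → Vec Bool k → Set
  Slice j y z = ∣ y ∣₁ ≡ j % q + q * fromBits (digits j ⊕ z)

  dot-tail : ∀ j z (u : Vec Bool r) → dot (tailCoefficients j) (map bit (z ++ u)) ≡ dot (flips q (digits j)) (map bit z)
  dot-tail j z u = begin
    dot (flips q (digits j) ++ replicate r 0ℤ) (map bit (z ++ u))                     ≡⟨ cong (dot (tailCoefficients j)) (map-++ bit z u) ⟩
    dot (flips q (digits j) ++ replicate r 0ℤ) (map bit z ++ map bit u)               ≡⟨ dot-++ (flips q (digits j)) (map bit z) (replicate r 0ℤ) (map bit u) ⟩
    dot (flips q (digits j)) (map bit z) ℤ.+ dot (replicate r 0ℤ) (map bit u)         ≡⟨ cong (ℤ._+_ (dot (flips q (digits j)) (map bit z))) (dot-zeroˡ (map bit u)) ⟩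
    dot (flips q (digits j)) (map bit z) ℤ.+ 0ℤ                                       ≡⟨ ℤ.+-identityʳ _ ⟩
    dot (flips q (digits j)) (map bit z)                                              ∎
    where open ≡-Reasoning

  dot-y : ∀ (c : Vec ℤ (k + r)) (y : Vec Bool m) (w : Vec Bool (k + r)) →
    dot (replicate m 1ℤ ++ c) (map bit (y ++ w)) ≡ + ∣ y ∣₁ ℤ.+ dot c (map bit w)
  dot-y c y w = trans (cong (dot (replicate m 1ℤ ++ c)) (map-++ bit y w))
    (trans (dot-++ (replicate m 1ℤ) (map bit y) c (map bit w)) (cong (ℤ._+ dot c (map bit w)) (dot-1s y)))

  -- `dot-flips` gives D = q⌊j/q⌋ - W, so ∣ y ∣₁ + D = j amounts to ∣ y ∣₁ = j % q + W. The bound on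
  -- j makes ⌊j/q⌋ fit into k bits.
  slice-equation : ∀ {j} → j < q * 2 ^ k → ∀ y z →
    (+ ∣ y ∣₁ ℤ.+ dot (flips q (digits j)) (map bit z) ≡ + j) ⇔ Slice j y z
  slice-equation {j} j<q2^k y z = mk⇔
    (λ eq → ℤ.+-injective (ℤ-group.∙-cancelʳ D _ _ (trans eq (sym A+W+D≡j))))
    (λ eq → trans (cong (λ y → + y ℤ.+ D) eq) A+W+D≡j)
    where
    open ≡-Reasoning
    D = dot (flips q (digits j)) (map bit z)
    W = q * fromBits (digits j ⊕ z)
    D+W : D ℤ.+ + W ≡ + (q * (j / q))
    D+W = begin
      D ℤ.+ + W                                        ≡⟨ cong (ℤ._+_ D) (ℤ.pos-* q _) ⟩
      D ℤ.+ + q ℤ.* + fromBits (digits j ⊕ z)          ≡⟨ dot-flips q (digits j) z ⟩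
      + q ℤ.* + fromBits (digits j)                    ≡⟨ cong (λ v → + q ℤ.* + v) (fromBits-toBits k (m<n*o⇒m/o<n (subst (j <_) (*-comm q (2 ^ k)) j<q2^k))) ⟩
      + q ℤ.* + (j / q)                                ≡⟨ ℤ.pos-* q (j / q) ⟨
      + (q * (j / q))                                  ∎
    A+W+D≡j : + (j % q + W) ℤ.+ D ≡ + j
    A+W+D≡j = begin
      + (j % q) ℤ.+ + W ℤ.+ D      ≡⟨ ℤ.+-assoc (+ (j % q)) (+ W) D ⟩
      + (j % q) ℤ.+ (+ W ℤ.+ D)    ≡⟨ cong (ℤ._+_ (+ (j % q))) (trans (ℤ.+-comm (+ W) D) D+W) ⟩
      + (j % q + q * (j / q))      ≡⟨ cong (λ p → + (j % q + p)) (*-comm q (j / q)) ⟩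
      + (j % q + j / q * q)        ≡⟨ cong +_ (m≡m%n+[m/n]*n j q) ⟨
      + j                          ∎

  level-inj₁ : ∀ j → level (inj₁ j) ≡ suc (toℕ j)
  level-inj₁ j = cong suc (toℕ-↑ˡ j (k + r))

  m<level-inj₂ : ∀ i → m < level (inj₂ i)
  m<level-inj₂ i rewrite toℕ-↑ʳ m i = s≤s (m≤m+n m (toℕ i))

  level-inj₁<q2^k : ∀ j → level (inj₁ j) < q * 2 ^ k
  level-inj₁<q2^k j rewrite level-inj₁ j = subst (suc (toℕ j) <_) 1+m≡q2^k (s≤s (toℕ<n j))

  0<q2^k : 0 < q * 2 ^ k
  0<q2^k = subst (0 <_) 1+m≡q2^k (s≤s z≤n)

  On-inj₁ : ∀ j y z u → On (inj₁ j) (y ++ (z ++ u)) ⇔ Slice (level (inj₁ j)) y z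
  On-inj₁ j y z u = subst (λ d → (d ≡ + N) ⇔ Slice N y z)
    (sym (trans (dot-y (tailCoefficients N) y (z ++ u)) (cong (ℤ._+_ (+ ∣ y ∣₁)) (dot-tail N z u))))
    (slice-equation (level-inj₁<q2^k j) y z)
    where N = level (inj₁ j)

  dot-inj₂ : ∀ i y z u → dot (1ℤ ∷ coefficients (inj₂ i)) (map bit (y ++ (z ++ u)))
    ≡ (+ ∣ y ∣₁ ℤ.+ dot (flips q (digits 0)) (map bit z)) ℤ.+ + level (inj₂ i) ℤ.* bit (lookup (z ++ u) i)
  dot-inj₂ i y z u = begin
    dot (1ℤ ∷ coefficients (inj₂ i)) (map bit (y ++ (z ++ u)))
      ≡⟨ dot-y (tailCoefficients 0 [ i ]%= (ℤ._+ N)) y (z ++ u) ⟩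
    + ∣ y ∣₁ ℤ.+ dot (tailCoefficients 0 [ i ]%= (ℤ._+ N)) (map bit (z ++ u))
      ≡⟨ cong (ℤ._+_ (+ ∣ y ∣₁)) (dot-updateAt (tailCoefficients 0) (map bit (z ++ u)) i N) ⟩
    + ∣ y ∣₁ ℤ.+ (dot (tailCoefficients 0) (map bit (z ++ u)) ℤ.+ N ℤ.* lookup (map bit (z ++ u)) i)
      ≡⟨ cong₂ (λ d b → + ∣ y ∣₁ ℤ.+ (d ℤ.+ N ℤ.* b)) (dot-tail 0 z u) (lookup-map i bit (z ++ u)) ⟩
    + ∣ y ∣₁ ℤ.+ (dot (flips q (digits 0)) (map bit z) ℤ.+ N ℤ.* bit (lookup (z ++ u) i))
      ≡⟨ ℤ.+-assoc (+ ∣ y ∣₁) D (N ℤ.* bit (lookup (z ++ u) i)) ⟨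
    (+ ∣ y ∣₁ ℤ.+ dot (flips q (digits 0)) (map bit z)) ℤ.+ N ℤ.* bit (lookup (z ++ u) i) ∎
    where
    open ≡-Reasoning
    N = + level (inj₂ i)
    D = dot (flips q (digits 0)) (map bit z)

  On-inj₂-true : ∀ i y z u → lookup (z ++ u) i ≡ true → Slice 0 y z → On (inj₂ i) (y ++ (z ++ u))
  On-inj₂-true i y z u wᵢ slice = begin
    dot (1ℤ ∷ coefficients (inj₂ i)) (map bit (y ++ (z ++ u)))    
      ≡⟨ dot-inj₂ i y z u ⟩
    + ∣ y ∣₁ ℤ.+ D ℤ.+ + level (inj₂ i) ℤ.* bit (lookup (z ++ u) i)
      ≡⟨ cong₂ (λ d b → d ℤ.+ + level (inj₂ i) ℤ.* bit b) (Equivalence.from (slice-equation 0<q2^k y z) slice) wᵢ ⟩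
    0ℤ ℤ.+ + level (inj₂ i) ℤ.* 1ℤ
      ≡⟨ trans (ℤ.+-identityˡ _) (ℤ.*-identityʳ (+ level (inj₂ i))) ⟩
    + level (inj₂ i) ∎
    where
    open ≡-Reasoning
    D = dot (flips q (digits 0)) (map bit z)

  -- Each replacement stays inside H_0: for wᵢ = 1 the two terms N cancel, and wᵢ = 0 is impossible.
  On-inj₂⇒Slice : ∀ i y z u → On (inj₂ i) (y ++ (z ++ u)) → Slice 0 y z
  On-inj₂⇒Slice i y z u on with lookup (z ++ u) i | dot-inj₂ i y z u
  ... | true | eq = Equivalence.to (slice-equation 0<q2^k y z)
    (ℤ-group.∙-cancelʳ (N ℤ.* 1ℤ) _ _ (trans (sym eq) (trans on (sym (trans (ℤ.+-identityˡ _) (ℤ.*-identityʳ N))))))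
    where N = + level (inj₂ i)
  -- Here the equation reads |y| = level (inj₂ i) + q·(digits 0 ⊕ z), which exceeds m.
  ... | false | eq = contradiction |y|≡N+W (<⇒≢ (≤-<-trans (∣∣₁≤n y) (<-≤-trans (m<level-inj₂ i) (m≤m+n (level (inj₂ i)) W))))
    where
    N = + level (inj₂ i)
    D = dot (flips q (digits 0)) (map bit z)
    W = q * fromBits (digits 0 ⊕ z)
    W+D≡0 : + W ℤ.+ D ≡ 0ℤ
    W+D≡0 = begin
      + W ℤ.+ D                                    ≡⟨ ℤ.+-comm (+ W) D ⟩
      D ℤ.+ + W                                    ≡⟨ cong (ℤ._+_ D) (ℤ.pos-* q (fromBits (digits 0 ⊕ z))) ⟩
      D ℤ.+ + q ℤ.* + fromBits (digits 0 ⊕ z)      ≡⟨ dot-flips q (digits 0) z ⟩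
      + q ℤ.* + fromBits (digits 0)                ≡⟨ cong (λ v → + q ℤ.* + v) (fromBits-0 k) ⟩
      + q ℤ.* 0ℤ                                   ≡⟨ ℤ.*-zeroʳ (+ q) ⟩
      0ℤ                                           ∎
      where open ≡-Reasoning
    |y|≡N+W : ∣ y ∣₁ ≡ level (inj₂ i) + W
    |y|≡N+W = ℤ.+-injective (ℤ-group.∙-cancelʳ D (+ ∣ y ∣₁) (N ℤ.+ + W) (begin
      + ∣ y ∣₁ ℤ.+ D                      ≡⟨ ℤ.+-identityʳ _ ⟨
      + ∣ y ∣₁ ℤ.+ D ℤ.+ 0ℤ               ≡⟨ cong (ℤ._+_ (+ ∣ y ∣₁ ℤ.+ D)) (ℤ.*-zeroʳ N) ⟨
      + ∣ y ∣₁ ℤ.+ D ℤ.+ N ℤ.* 0ℤ         ≡⟨ trans (sym eq) on ⟩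
      N                                   ≡⟨ ℤ.+-identityʳ N ⟨
      N ℤ.+ 0ℤ                            ≡⟨ cong (ℤ._+_ N) W+D≡0 ⟨
      N ℤ.+ (+ W ℤ.+ D)                   ≡⟨ ℤ.+-assoc N (+ W) D ⟨
      N ℤ.+ + W ℤ.+ D                     ∎))
      where open ≡-Reasoning

  -- The digits of j have to satisfy `digits j ⊕ z ≡ t` with t the bits of ⌊∣ y ∣₁/q⌋; xor with z is
  -- its own inverse, so they are t ⊕ z. Here k bits suffice because ∣ y ∣₁ ≤ m < q 2ᵏ.
  find-slice : ∀ y z → ∃ λ j → j < q * 2 ^ k × Slice j y z
  find-slice y z = j , j<q2^k , slice
    where
    x = ∣ y ∣₁
    t = toBits k (x / q)
    a = x % q
    j = a + q * fromBits (t ⊕ z)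
    a<q : a < q
    a<q = m%n<n x q
    j<q2^k : j < q * 2 ^ k
    j<q2^k = begin-strict
      a + q * fromBits (t ⊕ z)       <⟨ +-monoˡ-< _ a<q ⟩
      q + q * fromBits (t ⊕ z)       ≡⟨ *-suc q _ ⟨
      q * suc (fromBits (t ⊕ z))     ≤⟨ *-monoʳ-≤ q (fromBits<2^k (t ⊕ z)) ⟩
      q * 2 ^ k                      ∎
      where open ≤-Reasoning
    digits-j : digits j ≡ t ⊕ z
    digits-j = trans (cong (toBits k) (proj₂ (divMod-unique (fromBits (t ⊕ z)) a<q))) (toBits-fromBits (t ⊕ z))
    x<2^kq : x < 2 ^ k * q
    x<2^kq = subst (x <_) (trans 1+m≡q2^k (*-comm q (2 ^ k))) (s≤s (∣∣₁≤n y))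
    slice : x ≡ j % q + q * fromBits (digits j ⊕ z)
    slice = begin
      x                                       ≡⟨ m≡m%n+[m/n]*n x q ⟩
      a + x / q * q                           ≡⟨ cong (λ s → a + s) (*-comm (x / q) q) ⟩
      a + q * (x / q)                         ≡⟨ cong (λ v → a + q * v) (fromBits-toBits k (m<n*o⇒m/o<n x<2^kq)) ⟨
      a + q * fromBits t                      ≡⟨ cong (λ t → a + q * fromBits t) (⊕-cancelʳ t z) ⟨
      a + q * fromBits ((t ⊕ z) ⊕ z)          ≡⟨ cong₂ (λ a t → a + q * fromBits (t ⊕ z)) (proj₁ (divMod-unique (fromBits (t ⊕ z)) a<q)) digits-j ⟨
      j % q + q * fromBits (digits j ⊕ z)     ∎
      where open ≡-Reasoning

  -- The digits of 0 all vanish, so with z = 0 the equation of H_0 reduces to ∣ y ∣₁ = 0.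
  slice-0 : ∀ y z u → z ++ u ≡ replicate (k + r) false → Slice 0 y z → y ++ (z ++ u) ≡ replicate n false
  slice-0 y z u w≡0 slice = trans (cong₂ _++_ (∣∣₁-0 y |y|≡0) w≡0) (sym (replicate-++ m false))
    where
    open ≡-Reasoning
    z≡0 : z ≡ replicate k false
    z≡0 = ++-injectiveˡ z (replicate k false) (trans w≡0 (replicate-++ k false))
    |y|≡0 : ∣ y ∣₁ ≡ 0
    |y|≡0 = begin
      ∣ y ∣₁                                                     ≡⟨ slice ⟩
      q * fromBits (replicate k false ⊕ z)                       ≡⟨ cong (λ z → q * fromBits (replicate k false ⊕ z)) z≡0 ⟩
      q * fromBits (replicate k false ⊕ replicate k false)       ≡⟨ cong (λ v → q * fromBits v) (zipWith-replicate {n = k} _xor_ false false) ⟩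
      q * fromBits (replicate k false)                           ≡⟨ cong (q *_) (fromBits-0 k) ⟩
      q * 0                                                      ≡⟨ *-zeroʳ q ⟩
      0                                                          ∎

  some-On : ∀ v → v ≢ replicate n false → ∃ λ s → On s v
  some-On v v≢0 with y , w , refl ← splitAt m v with z , u , refl ← splitAt k w with find-slice y z
  ... | suc j , 1+j<q2^k , slice = inj₁ (fromℕ< j<m) , Equivalence.from (On-inj₁ (fromℕ< j<m) y z u)
    (subst (λ j → Slice j y z) (sym (trans (level-inj₁ (fromℕ< j<m)) (cong suc (toℕ-fromℕ< j<m)))) slice)
    where
    j<m : j < m
    j<m = ≤-pred (subst (suc j <_) (sym 1+m≡q2^k) 1+j<q2^k)
  -- The point lies on H_0, and any coordinate of w that is set selects a replacement containing it.
  ... | zero , _ , slice with some-true (z ++ u)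
  ...   | inj₁ (i , wᵢ) = inj₂ i , On-inj₂-true i y z u wᵢ slice
  ...   | inj₂ w≡0      = contradiction (slice-0 y z u w≡0 slice) v≢0

  count : Index → ℕ
  count s = ∑ᶜ n (⟪_⟫ ∘ On? s)

  count-bound : ∀ s → ∃ λ x → count s ≤ 2 ^ r * ∑ᶜ m (λ y → ⟪ q ∣? (x + ∣ y ∣₁) ⟫)
  count-bound s@(inj₁ j) = l * (level s % q) , fibre-count l (level s % q) (digits (level s)) r (On? s)
    λ y z u → Equivalence.to (On-inj₁ j y z u)
  count-bound s@(inj₂ i) = l * (0 % q) , fibre-count l (0 % q) (digits 0) r (On? s) (On-inj₂⇒Slice i)

  𝓗 : Vector.Vector (Hyperplane n) n
  𝓗 i = monic (coefficients (Fin.splitAt m i)) (+ level (Fin.splitAt m i))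

  admissible : Admissible 𝓗
  admissible = record
    -- The constant term of a monic hyperplane is determined by its points, and the level is the
    -- index plus 1.
    { distinct = λ i j i≐j → toℕ-injective (begin
        toℕ i                                    ≡⟨ cong toℕ (join-splitAt m (k + r) i) ⟨
        toℕ (join m (k + r) (Fin.splitAt m i))   ≡⟨ suc-injective (ℤ.+-injective (monic-injective (coefficients (Fin.splitAt m i)) (coefficients (Fin.splitAt m j)) (+ level (Fin.splitAt m i)) (+ level (Fin.splitAt m j)) i≐j)) ⟩
        toℕ (join m (k + r) (Fin.splitAt m j))   ≡⟨ cong toℕ (join-splitAt m (k + r) j) ⟩
        toℕ j                                    ∎)
    ; avoids = λ i → origin∉monic (coefficients (Fin.splitAt m i)) {+ level (Fin.splitAt m i)} λ ()
    ; covers = λ v v≢0 → let s , on = some-On v v≢0 in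
        join m (k + r) s , subst (λ s → vertex v U.∈ ⟦ monic (coefficients s) (+ level s) ⟧) (sym (splitAt-join m (k + r) s))
          (Equivalence.from (vertex∈monic (coefficients s) (+ level s) v) on)
    }
    where open ≡-Reasoning

  maxIncidence : MaxIncidence 𝓗 (Vector.foldr _⊔_ 0 (count ∘ Fin.splitAt m))
  maxIncidence = count ∘ Fin.splitAt m
    , (λ i → cube-cardinality (On? (Fin.splitAt m i)) (vertex∈monic (coefficients (Fin.splitAt m i)) (+ level (Fin.splitAt m i))))
    , refl

-- Asymptotics

n<2^n : ∀ n → n < 2 ^ n
n<2^n zero    = s≤s z≤n
n<2^n (suc n) = begin-strict
  suc n            ≤⟨ n<2^n n ⟩
  2 ^ n            <⟨ m<m+n (2 ^ n) (m^n>0 2 n) ⟩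
  2 ^ n + 2 ^ n    ≡⟨ cong (λ p → 2 ^ n + p) (+-identityʳ (2 ^ n)) ⟨
  2 ^ suc n        ∎
  where open ≤-Reasoning

-- A floating-point form of n = d + Q with mantissa p and exponent k. Induction on d raises the
-- mantissa when n reaches (p + 1)2ᵏ and renormalises it to Q when it would become 2Q.
dyadic-scale : ∀ Q .{{_ : NonZero Q}} d → ∃₂ λ k p →
  Q ≤ p × p < 2 * Q × p * 2 ^ k ≤ d + Q × d + Q < suc p * 2 ^ k
dyadic-scale Q zero = 0 , Q , ≤-refl , m<m+n Q (≤-trans (>-nonZero⁻¹ Q) (m≤m+n Q 0))
  , ≤-reflexive (*-identityʳ Q) , ≤-reflexive (sym (*-identityʳ (suc Q)))
dyadic-scale Q (suc d) with dyadic-scale Q d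
... | k , p , Q≤p , p<2Q , p2^k≤n , n<[1+p]2^k with suc (d + Q) <? suc p * 2 ^ k
...   | yes 1+n< = k , p , Q≤p , p<2Q , m≤n⇒m≤1+n p2^k≤n , 1+n<
...   | no  1+n≮ with 1+n≡ ← ≤-antisym n<[1+p]2^k (≮⇒≥ 1+n≮) | suc p <? 2 * Q
...     | yes 1+p<2Q = k , suc p , m≤n⇒m≤1+n Q≤p , 1+p<2Q , ≤-reflexive (sym 1+n≡)
  , subst (_< suc (suc p) * 2 ^ k) (sym 1+n≡) (m<n+m _ (m^n>0 2 k))
...     | no  1+p≮2Q = suc k , Q , ≤-refl , m<m+n Q (≤-trans (>-nonZero⁻¹ Q) (m≤m+n Q 0))
  , ≤-reflexive (sym 1+n≡Q2^[1+k])
  , subst (_< suc Q * 2 ^ suc k) (sym 1+n≡Q2^[1+k]) (m<n+m _ (m^n>0 2 (suc k)))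
  where
  lemma : ∀ Q r → (2 * Q) * r ≡ Q * (r + (r + 0))
  lemma = solve-∀
  1+n≡Q2^[1+k] : suc (d + Q) ≡ Q * 2 ^ suc k
  1+n≡Q2^[1+k] = trans 1+n≡ (trans (cong (_* 2 ^ k) (≤-antisym p<2Q (≮⇒≥ 1+p≮2Q))) (lemma Q (2 ^ k)))

-- The maximum of finitely many thresholds. The mantissa stays bounded while n grows, so one
-- threshold serves every n.
uniform-threshold : {P : ℕ → ℕ → Set} → (∀ q → ∃ λ N → ∀ m → N ≤ m → P q m) →
  ∀ B → ∃ λ N → ∀ q → q < B → ∀ m → N ≤ m → P q m
uniform-threshold h zero    = 0 , λ _ ()
uniform-threshold h (suc B) with N , hN ← uniform-threshold h B | M , hM ← h B
  = N ⊔ M , λ q q<1+B m N⊔M≤m → case m<1+n⇒m<n∨m≡n q<1+B of λ where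
      (inj₁ q<B)  → hN q q<B m (≤-trans (m≤m⊔n N M) N⊔M≤m)
      (inj₂ refl) → hM m (≤-trans (m≤n⊔m N M) N⊔M≤m)

≤max : ∀ {n} (c : Vector.Vector ℕ n) i → c i ≤ Vector.foldr _⊔_ 0 c
≤max c zero    = m≤m⊔n _ _
≤max c (suc i) = ≤-trans (≤max (c ∘ suc) i) (m≤n⊔m _ _)

*-max≤ : ∀ {n} A {B} (c : Vector.Vector ℕ n) → (∀ i → A * c i ≤ B) → A * Vector.foldr _⊔_ 0 c ≤ B
*-max≤ {zero}  A c h = ≤-trans (≤-reflexive (*-zeroʳ A)) z≤n
*-max≤ {suc n} A c h = ≤-trans (≤-reflexive (*-distribˡ-⊔ A (c zero) _)) (⊔-lub (h zero) (*-max≤ A (c ∘ suc) (h ∘ suc)))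

construction-bound : ∀ E l k r m′ → suc (suc m′) ≡ suc l * 2 ^ k →
  (∀ x → E * (suc l * ∑ᶜ (suc m′) (λ v → ⟪ suc l ∣? (x + ∣ v ∣₁) ⟫)) ≤ suc E * 2 ^ suc m′) →
  ∃ λ c → Attained (suc m′ + (k + r)) c × E * suc l * c ≤ suc E * 2 ^ (suc m′ + r)
construction-bound E l k r m′ 1+m≡q2^k equi = _ , (𝓗 , admissible , maxIncidence) , *-max≤ (E * q) _ λ i → bound (Fin.splitAt m i)
  where
  open Construction l k r m′ 1+m≡q2^k
  open ≤-Reasoning
  lemma : ∀ E q R S → E * q * (R * S) ≡ E * (q * S) * R
  lemma = solve-∀
  bound : ∀ s → E * q * count s ≤ suc E * 2 ^ (m + r)
  bound s with x , count≤ ← count-bound s = begin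
    E * q * count s                                               ≤⟨ *-monoʳ-≤ (E * q) count≤ ⟩
    E * q * (2 ^ r * ∑ᶜ m (λ v → ⟪ q ∣? (x + ∣ v ∣₁) ⟫))          ≡⟨ lemma E q (2 ^ r) _ ⟩
    E * (q * ∑ᶜ m (λ v → ⟪ q ∣? (x + ∣ v ∣₁) ⟫)) * 2 ^ r          ≤⟨ *-monoˡ-≤ (2 ^ r) (equi x) ⟩
    suc E * 2 ^ m * 2 ^ r                                         ≡⟨ *-assoc (suc E) (2 ^ m) (2 ^ r) ⟩
    suc E * (2 ^ m * 2 ^ r)                                       ≡⟨ cong (λ p → suc E * p) (^-distribˡ-+-* 2 m r) ⟨
    suc E * 2 ^ (m + r)                                           ∎

-- The parameters: suc q · 2ᵏ ≤ n < (q + 2) · 2ᵏ with 2E ≤ q ≤ 4E, m = q·2ᵏ − 1, and r takes up the slack.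
upper-bound : ∀ E .{{_ : NonZero E}} → ∃ λ N → ∀ n → N ≤ n →
  ∃ λ c → Attained n c × E * E * (n * c) ≤ suc E * suc E * 2 ^ n
-- n ≥ Q is the range of `dyadic-scale`; n ≥ 2(N + 1) gives m ≥ N, because n < 2(m + 1).
upper-bound E = Q + 2 * suc N , main
  where
  -- q is the mantissa less 1, so this Q yields q ≥ 2E; the 2ᵏ given up leaves room for the k
  -- coordinates of z.
  Q = suc (2 * E)
  Equidistributed : ℕ → ℕ → Set
  Equidistributed q m = 2 ≤ q → ∀ x → E * (q * ∑ᶜ m (λ v → ⟪ q ∣? (x + ∣ v ∣₁) ⟫)) ≤ suc E * 2 ^ m
  thresholds : ∀ q → ∃ λ N → ∀ m → N ≤ m → Equidistributed q m
  thresholds q with 2 ≤? q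
  ... | yes 2≤q with N , h ← equidistribution q 2≤q E = N , λ m N≤m _ → h m N≤m
  ... | no  2≰q = 0 , λ m _ 2≤q → contradiction 2≤q 2≰q
  N = proj₁ (uniform-threshold thresholds (2 * Q))
  N-threshold = proj₂ (uniform-threshold thresholds (2 * Q))
  finish : ∀ {n k q} → 2 ≤ q → 2 * E ≤ q → q < 2 * Q → 2 * suc N ≤ n →
    suc q * 2 ^ k ≤ n → n < suc (suc q) * 2 ^ k →
    ∃ λ c → Attained n c × E * E * (n * c) ≤ suc E * suc E * 2 ^ n
  finish {n} {k} {q@(suc l)} 2≤q 2E≤q q<2Q 2[1+N]≤n [1+q]2^k≤n n<[2+q]2^k =
    let c , attained , c-bound = construction-bound E l k r m′ 1+m≡q2^k (N-threshold q q<2Q m N≤m 2≤q)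
    in c , subst (λ n → Attained n c) m+[k+r]≡n attained , (begin
      -- One factor (E + 1)/E pays for n against m + 1 = q 2ᵏ, the other for the unevenness of ∣ y
      -- ∣₁ modulo q.
      E * E * (n * c)                                  ≡⟨ lemma₁ E n c ⟩
      E * n * (E * c)                                  ≤⟨ *-monoˡ-≤ (E * c) En≤[1+E]q2^k ⟩
      suc E * (q * 2 ^ k) * (E * c)                    ≡⟨ lemma₂ (suc E) q (2 ^ k) E c ⟩
      suc E * 2 ^ k * (E * q * c)                      ≤⟨ *-monoʳ-≤ (suc E * 2 ^ k) c-bound ⟩
      suc E * 2 ^ k * (suc E * 2 ^ (m + r))            ≡⟨ lemma₃ (suc E) (2 ^ k) (2 ^ (m + r)) ⟩
      suc E * suc E * (2 ^ k * 2 ^ (m + r))            ≡⟨ cong (λ p → suc E * suc E * p) (^-distribˡ-+-* 2 k (m + r)) ⟨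
      suc E * suc E * 2 ^ (k + (m + r))                ≡⟨ cong (λ p → suc E * suc E * 2 ^ p) (trans (lemma₄ k m r) m+[k+r]≡n) ⟩
      suc E * suc E * 2 ^ n                            ∎)
    where
    open ≤-Reasoning
    -- The subtraction is exact because q ≥ 2.
    m′ = q * 2 ^ k ∸ 2
    m = suc m′
    1+m≡q2^k : suc m ≡ q * 2 ^ k
    1+m≡q2^k = m+[n∸m]≡n (≤-trans 2≤q (m≤m*n q (2 ^ k) {{m^n≢0 2 k}}))
    m+k≤n : m + k ≤ n
    m+k≤n = begin
      m + k                  ≤⟨ +-mono-≤ (n≤1+n m) (<⇒≤ (n<2^n k)) ⟩
      suc m + 2 ^ k          ≡⟨ cong (_+ 2 ^ k) 1+m≡q2^k ⟩
      q * 2 ^ k + 2 ^ k      ≡⟨ +-comm (q * 2 ^ k) (2 ^ k) ⟩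
      suc q * 2 ^ k          ≤⟨ [1+q]2^k≤n ⟩
      n                      ∎
    r = n ∸ (m + k)
    m+[k+r]≡n : m + (k + r) ≡ n
    m+[k+r]≡n = trans (sym (+-assoc m k r)) (m+[n∸m]≡n m+k≤n)
    N≤m : N ≤ m
    N≤m = ≤-pred (<⇒≤ (*-cancelˡ-< 2 (suc N) (suc m) (begin-strict
      2 * suc N                 ≤⟨ 2[1+N]≤n ⟩
      n                         <⟨ n<[2+q]2^k ⟩
      (2 + q) * 2 ^ k           ≤⟨ *-monoˡ-≤ (2 ^ k) (+-mono-≤ 2≤q (≤-reflexive (sym (+-identityʳ q)))) ⟩
      (2 * q) * 2 ^ k           ≡⟨ *-assoc 2 q (2 ^ k) ⟩
      2 * (q * 2 ^ k)           ≡⟨ cong (λ p → 2 * p) 1+m≡q2^k ⟨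
      2 * suc m                 ∎)))
    lemma₅ : ∀ E q P → E * ((2 + q) * P) ≡ (2 * E + E * q) * P
    lemma₅ = solve-∀
    -- n/(q 2ᵏ) < 1 + 2/q, and 2/q ≤ 1/E.
    En≤[1+E]q2^k : E * n ≤ suc E * (q * 2 ^ k)
    En≤[1+E]q2^k = begin
      E * n                          ≤⟨ *-monoʳ-≤ E (<⇒≤ n<[2+q]2^k) ⟩
      E * ((2 + q) * 2 ^ k)          ≡⟨ lemma₅ E q (2 ^ k) ⟩
      (2 * E + E * q) * 2 ^ k        ≤⟨ *-monoˡ-≤ (2 ^ k) (+-monoˡ-≤ (E * q) 2E≤q) ⟩
      suc E * q * 2 ^ k              ≡⟨ *-assoc (suc E) q (2 ^ k) ⟩
      suc E * (q * 2 ^ k)            ∎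
    lemma₁ : ∀ E n c → E * E * (n * c) ≡ E * n * (E * c)
    lemma₁ = solve-∀
    lemma₂ : ∀ A q P E c → A * (q * P) * (E * c) ≡ A * P * (E * q * c)
    lemma₂ = solve-∀
    lemma₃ : ∀ A P R → A * P * (A * R) ≡ A * A * (P * R)
    lemma₃ = solve-∀
    lemma₄ : ∀ k m r → k + (m + r) ≡ m + (k + r)
    lemma₄ = solve-∀
  main : ∀ n → Q + 2 * suc N ≤ n → ∃ λ c → Attained n c × E * E * (n * c) ≤ suc E * suc E * 2 ^ n
  main n N≤n with dyadic-scale Q (n ∸ Q)
  ... | scale rewrite m∸n+n≡m (m+n≤o⇒m≤o Q N≤n) with scale
  ...   | k , suc q , s≤s 2E≤q , 1+q<2Q , [1+q]2^k≤n , n<[2+q]2^k =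
    finish {k = k} (≤-trans (*-monoʳ-≤ 2 (>-nonZero⁻¹ E)) 2E≤q) 2E≤q (<-trans (n<1+n q) 1+q<2Q)
      (m+n≤o⇒n≤o Q N≤n) [1+q]2^k≤n n<[2+q]2^k

-- Lower bound by counting covered points

cover-length : ∀ {n} (L : List (Vec Bool n)) → (∀ v → v ∈ L) → 2 ^ n ≤ length L
cover-length {n} L all∈L = begin
  2 ^ n                                  ≡⟨ *-identityʳ (2 ^ n) ⟨
  2 ^ n * 1                              ≡⟨ ∑ᶜ-const n 1 ⟨
  ∑ᶜ n (λ _ → 1)                         ≡⟨ ∑ᶜ-cong n (λ v → ⟪⟫-true (v ∈? L) (all∈L v)) ⟨
  ∑ᶜ n (λ v → ⟪ v ∈? L ⟫)                ≤⟨ count-∈ L ⟩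
  length L                               ∎
  where
  open ≤-Reasoning
  _≟ᵛ_ = ≡-dec {n = n} Bool._≟_
  open import Data.List.Membership.DecPropositional _≟ᵛ_ using (_∈?_)
  split : ∀ x L v → ⟪ v ∈? (x ∷ L) ⟫ ≤ ⟪ v ≟ᵛ x ⟫ + ⟪ v ∈? L ⟫
  split x L v with v ≟ᵛ x
  ... | yes _ = m≤m+n 1 ⟪ v ∈? L ⟫
  ... | no  _ = ≤-refl
  count-∈ : ∀ L → ∑ᶜ n (λ v → ⟪ v ∈? L ⟫) ≤ length L
  count-∈ []      = ≤-reflexive (trans (∑ᶜ-const n 0) (*-zeroʳ (2 ^ n)))
  count-∈ (x ∷ L) = begin
    -- Each list entry accounts for at most one point, so repetitions only help.
    ∑ᶜ n (λ v → ⟪ v ∈? (x ∷ L) ⟫)                         ≤⟨ ∑ᶜ-mono n (split x L) ⟩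
    ∑ᶜ n (λ v → ⟪ v ≟ᵛ x ⟫ + ⟪ v ∈? L ⟫)                  ≡⟨ ∑ᶜ-+ n (λ v → ⟪ v ≟ᵛ x ⟫) (λ v → ⟪ v ∈? L ⟫) ⟩
    ∑ᶜ n (λ v → ⟪ v ≟ᵛ x ⟫) + ∑ᶜ n (λ v → ⟪ v ∈? L ⟫)     ≤⟨ +-mono-≤ (∑ᶜ-unique n (_≟ᵛ x) λ p q → trans p (sym q)) (count-∈ L) ⟩
    1 + length L                                          ∎

length-concat-tabulate : ∀ {n} {A : Set} (xs : Fin n → List A) {c} → (∀ i → length (xs i) ≤ c) →
  length (concat (List.tabulate xs)) ≤ n * c
length-concat-tabulate {zero}  xs ≤c = z≤n
length-concat-tabulate {suc n} xs ≤c = ≤-trans (≤-reflexive (length-++ (xs zero)))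
  (+-mono-≤ (≤c zero) (length-concat-tabulate (xs ∘ suc) (≤c ∘ suc)))

-- The origin and the members of the n hyperplanes together exhaust the cube, and c bounds the size
-- of each hyperplane's list.
lower-bound : ∀ {n c} → Attained n c → 2 ^ n ≤ suc (n * c)
lower-bound {n} {c} (𝓗 , admissible , counts , cards , max≡c) =
  ≤-trans (cover-length (replicate n false ∷ concat (List.tabulate members)) covered)
          (s≤s (length-concat-tabulate members members≤c))
  where
  open Admissible admissible
  members : Fin n → List (Vec Bool n)
  members i = proj₁ (cards i)
  members≤c : ∀ i → length (members i) ≤ c
  members≤c i with _ , _ , _ , length≡ ← cards i = subst (_ ≤_) max≡c (≤-trans (≤-reflexive length≡) (≤max counts i))
  covered : ∀ v → v ∈ replicate n false ∷ concat (List.tabulate members)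
  covered v with ≡-dec Bool._≟_ v (replicate n false)
  ... | yes v≡0 = here v≡0
  ... | no  v≢0 with i , v∈Hᵢ ← covers v v≢0 with _ , _ , ∈⇔ , _ ← cards i in eq =
    there (∈-concat⁺′ (subst (λ p → v ∈ proj₁ p) (sym eq) (Equivalence.from (∈⇔ v) v∈Hᵢ)) (∈-tabulate⁺ i))

-- From integer inequalities to the limit

distance-lemma : ∀ E X Y → 0 < Y → E * X < E * Y + Y → E * Y < E * X + Y → E * ℤ.∣ X ℤ.⊖ Y ∣ < Y
distance-lemma E X Y 0<Y hX hY with ≤-total X Y
... | inj₁ X≤Y rewrite ℤ.∣⊖∣-≤ X≤Y | *-distribˡ-∸ E Y X =
  +-cancelˡ-< (E * X) _ _ (subst (_< E * X + Y) (sym (m+[n∸m]≡n (*-monoʳ-≤ E X≤Y))) hY)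
... | inj₂ Y≤X rewrite ℤ.∣m⊖n∣≡∣n⊖m∣ X Y | ℤ.∣⊖∣-≤ Y≤X | *-distribˡ-∸ E X Y =
  +-cancelˡ-< (E * Y) _ _ (subst (_< E * Y + Y) (sym (m+[n∸m]≡n (*-monoʳ-≤ E Y≤X))) hX)

-- A positive rational is at least 1 over its denominator, so the error only has to beat 1/↧ₙ ε.
-- Unnormalised rationals keep gcds out of the comparison.
ratio-near-1 : ∀ X Y .{{_ : NonZero Y}} ε → 0ℚ ℚ.< ε → ℚ.↧ₙ ε * ℤ.∣ X ℤ.⊖ Y ∣ < Y → ℚ.∣ (+ X) ℚ./ Y ℚ.- 1ℚ ∣ ℚ.< ε
ratio-near-1 X Y@(suc y) (mkℚ +[1+ p ] d _) _ close = ℚ.toℚᵘ-cancel-< (ℚᵘ.<-respˡ-≃ (ℚᵘ.≃-sym ≃dist) (ℚᵘ.*<* (begin-strict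
  + ℤ.∣ + X ℤ.* 1ℤ ℤ.+ (ℤ.- 1ℤ) ℤ.* + Y ∣ ℤ.* + suc d    ≡⟨ cong (λ z → + ℤ.∣ z ∣ ℤ.* + suc d) num ⟩
  + ℤ.∣ X ℤ.⊖ Y ∣ ℤ.* + suc d                            ≡⟨ trans (sym (ℤ.pos-* ℤ.∣ X ℤ.⊖ Y ∣ (suc d))) (cong +_ (*-comm ℤ.∣ X ℤ.⊖ Y ∣ (suc d))) ⟩
  + (suc d * ℤ.∣ X ℤ.⊖ Y ∣)                              <⟨ ℤ.+<+ close ⟩
  + Y                                                    ≤⟨ ℤ.+≤+ (≤-trans (m≤m+n Y (p * Y)) (≤-reflexive (cong (λ z → suc p * z) (sym (*-identityʳ Y))))) ⟩
  + (suc p * (Y * 1))                                    ≡⟨ ℤ.pos-* (suc p) (Y * 1) ⟩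
  + suc p ℤ.* + (Y * 1)                                  ∎)))
  where
  open ℤ.≤-Reasoning
  num : + X ℤ.* 1ℤ ℤ.+ (ℤ.- 1ℤ) ℤ.* + Y ≡ X ℤ.⊖ Y
  num = trans (cong₂ ℤ._+_ (ℤ.*-identityʳ (+ X)) (ℤ.-1*i≡-i (+ Y))) (ℤ.m-n≡m⊖n X Y)
  ≃dist : toℚᵘ ℚ.∣ (+ X) ℚ./ Y ℚ.- 1ℚ ∣ ℚᵘ.≃ ℚᵘ.∣ ℚᵘ.mkℚᵘ (+ X) y ℚᵘ.- ℚᵘ.1ℚᵘ ∣
  ≃dist = ℚᵘ.≃-trans (ℚ.toℚᵘ-homo-∣-∣ _) (ℚᵘ.∣-∣-cong (ℚᵘ.≃-trans (ℚ.toℚᵘ-homo-+ ((+ X) ℚ./ Y) (ℚ.- 1ℚ))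
    (ℚᵘ.+-cong (ℚ.toℚᵘ-fromℚᵘ (ℚᵘ.mkℚᵘ (+ X) y)) ℚᵘ.≃-refl)))
ratio-near-1 X Y (mkℚ (+ 0) _ _)      (ℚ.*<* (ℤ.+<+ ())) _
ratio-near-1 X Y (mkℚ (-[1+ _ ]) _ _) (ℚ.*<* ())          _

-- (3E + 1)² < 9E (E + 1).
square-slack : ∀ E .{{_ : NonZero E}} {X Y} → 0 < Y →
  3 * E * (3 * E) * X ≤ suc (3 * E) * suc (3 * E) * Y → E * X < E * Y + Y
square-slack E@(suc d) {X} {Y} 0<Y bound = *-cancelˡ-< (9 * E) (E * X) (E * Y + Y) (begin-strict
  9 * E * (E * X)                                      ≡⟨ lemma₁ E X ⟩
  3 * E * (3 * E) * X                                  ≤⟨ bound ⟩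
  suc (3 * E) * suc (3 * E) * Y                        <⟨ m<m+n _ 0<Y ⟩
  suc (3 * E) * suc (3 * E) * Y + Y                    ≤⟨ m≤m+n _ ((3 * d + 1) * Y) ⟩
  suc (3 * E) * suc (3 * E) * Y + Y + (3 * d + 1) * Y  ≡⟨ lemma₂ d Y ⟩
  9 * E * (E * Y + Y)                                  ∎)
  where
  open ≤-Reasoning
  lemma₁ : ∀ E X → 9 * E * (E * X) ≡ 3 * E * (3 * E) * X
  lemma₁ = solve-∀
  lemma₂ : ∀ d Y → suc (3 * suc d) * suc (3 * suc d) * Y + Y + (3 * d + 1) * Y ≡ 9 * suc d * (suc d * Y + Y)
  lemma₂ = solve-∀

-- With E the denominator of ε: from above, (1 + 1/(3E))² < 1 + 1/E by `square-slack`; from below,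
-- the uncovered origin costs a relative 2⁻ⁿ, less than 1/E since E ≤ n < 2ⁿ.
normalised-near-1 : ∀ ε → 0ℚ ℚ.< ε → ∀ n c → ℚ.↧ₙ ε ≤ n → 2 ^ n ≤ suc (n * c) →
  3 * ℚ.↧ₙ ε * (3 * ℚ.↧ₙ ε) * (n * c) ≤ suc (3 * ℚ.↧ₙ ε) * suc (3 * ℚ.↧ₙ ε) * 2 ^ n →
  ℚ.∣ normalised n c ℚ.- 1ℚ ∣ ℚ.< ε
normalised-near-1 ε 0<ε n c E≤n lower upper = ratio-near-1 (n * c) (2 ^ n) {{m^n≢0 2 n}} ε 0<ε
  (distance-lemma E (n * c) (2 ^ n) (m^n>0 2 n) (square-slack E (m^n>0 2 n) upper) (begin-strict
    E * 2 ^ n            ≤⟨ *-monoʳ-≤ E lower ⟩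
    E * suc (n * c)      ≡⟨ trans (*-suc E (n * c)) (+-comm E (E * (n * c))) ⟩
    E * (n * c) + E      <⟨ +-monoʳ-< (E * (n * c)) (≤-<-trans E≤n (n<2^n n)) ⟩
    E * (n * c) + 2 ^ n  ∎))
  where
  open ≤-Reasoning
  E = ℚ.↧ₙ ε

theorem1p3 : (F : ℕ → ℕ) → (∀ n → .{{NonZero n}} → IsMinimum (Attained n) (F n)) → (λ n → normalised n (F n)) ⟶ 1ℚ
theorem1p3 F F-min ε 0<ε with N , bound ← upper-bound (3 * ℚ.↧ₙ ε) = N + ℚ.↧ₙ ε , near
  where
  near : ∀ n → N + ℚ.↧ₙ ε ≤ n → ℚ.∣ normalised n (F n) ℚ.- 1ℚ ∣ ℚ.< ε
  -- The denominator of ε is at least 1, which excludes n = 0, where F is unconstrained.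
  near zero      N+E≤0 with () ← ≤-trans (m≤n+m _ N) N+E≤0
  near n@(suc _) N+E≤n with c , c-attained , c-bound ← bound n (m+n≤o⇒m≤o N N+E≤n) =
    normalised-near-1 ε 0<ε n (F n) (m+n≤o⇒n≤o N N+E≤n) (lower-bound (proj₁ (F-min n)))
      (≤-trans (*-monoʳ-≤ (3 * ℚ.↧ₙ ε * (3 * ℚ.↧ₙ ε)) (*-monoʳ-≤ n (proj₂ (F-min n) c c-attained))) c-bound)
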